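{- Let $m\ge 2$. Then, as formal power series in $q,z_1,\ldots,z_m$, $$\sum_{\mu\in\mathcal{D}_m} z_1^{s_1(\mu)}\cdots z_{m-1}^{s_{m-1}(\mu)}z_m^{s_m(\mu)}q^{|\mu|}=\sum_{\lambda\in\mathcal{O}_m} z_1^{\ell_1(\lambda)}\cdots z_{m-1}^{\ell_{m-1}(\lambda)}z_m^{\lfloor \lambda_1/m\rfloor-\mathrm{asc}(\lambda)}q^{|\lambda|}.$$
   Context: A partition $\lambda=(\lambda_1,\lambda_2,\ldots)$ is a nonincreasing sequence of nonnegative integers with finitely many nonzero terms (zeros appended as needed); $|\lambda|=\sum_i\lambda_i$. For $1\le i\le m$, $s_i(\lambda)=\lambda_i-\lambda_{i+1}+\lambda_{m+i}-\lambda_{m+i+1}+\lambda_{2m+i}-\lambda_{2m+i+1}+\cdots$, and $\ell_i(\lambda)=\#\{j:\lambda_j>0,\ \lambda_j\equiv i\pmod m\}$. $\mathcal{D}_m$ is the set of partitions in which each nonzero part appears at most $m-1$ times; $\mathcal{O}_m$ is the set of partitions none of whose nonzero parts is divisible by $m$. For $\lambda$ with nonzero parts $\lambda_1\ge\cdots\ge\lambda_r$, let $v_i$ be the least nonnegative residue of $\lambda_i$ modulo $m$; then $\mathrm{asc}(\lambda)=\#\{i:1\le i<r,\ v_i<v_{i+1}\}$. -}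

module Defs where

open import Data.Nat using (ℕ; zero; suc; _+_; _∸_; _≤_; _<ᵇ_; _≡ᵇ_; _≤ᵇ_; NonZero)
open import Data.Nat.DivMod using (_/_; _%_)
open import Data.Nat.ListAction using (sum)
open import Data.Integer as ℤ using (ℤ; +_)
open import Data.Bool using (Bool; true; false; _∧_; not; if_then_else_)
open import Data.List using (List; []; _∷_; length; map; concatMap; filterᵇ; upTo; allFin)
open import Data.Fin using (Fin; toℕ)
open import Data.Vec using (Vec; tabulate)
open import Data.Vec.Properties using () renaming (≡-dec to vec-≡-dec)
open import Data.Integer.Properties using () renaming (_≟_ to _≟ℤ_)
open import Relation.Nullary.Decidable using (⌊_⌋)

-- A partition is represented by the list of its NONZERO parts, in
-- nonincreasing order: λ = (λ₁ ≥ λ₂ ≥ ⋯ ≥ λᵣ > 0).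

-- ptns f n k : all partitions of n with all parts ≤ k (fuel f ≥ n suffices).
ptns : ℕ → ℕ → ℕ → List (List ℕ)
ptns zero    zero    k = [] ∷ []
ptns zero    (suc n) k = []
ptns (suc f) zero    k = [] ∷ []
ptns (suc f) (suc n) k =
  concatMap (λ j → map (j ∷_) (ptns f (suc n ∸ j) j))
            (filterᵇ (λ j → j ≤ᵇ k) (Data.List.map suc (upTo (suc n))))

partitions : ℕ → List (List ℕ)
partitions n = ptns n n n

-- λ_i (1-indexed), with zeros appended.
part : List ℕ → ℕ → ℕ
part []       _             = 0
part (x ∷ xs) zero          = 0
part (x ∷ xs) (suc zero)    = x
part (x ∷ xs) (suc (suc i)) = part xs (suc i)

size : List ℕ → ℕ
size = sum

countᵇ : {A : Set} → (A → Bool) → List A → ℕ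
countᵇ p xs = length (filterᵇ p xs)

module _ (m : ℕ) .{{_ : NonZero m}} where

  -- s_i(λ) = Σ_{k ≥ 0} (λ_{km+i} − λ_{km+i+1})  (terms with km+i > r vanish)
  sᵢ : ℕ → List ℕ → ℕ
  sᵢ i la = sum (map (λ k → part la (k Data.Nat.* m + i) ∸ part la (k Data.Nat.* m + i + 1))
                    (upTo (suc (length la))))

  ℓᵢ : ℕ → List ℕ → ℕ
  ℓᵢ i la = countᵇ (λ x → (x % m) ≡ᵇ (i % m)) la

  ascList : List ℕ → ℕ
  ascList []           = 0
  ascList (x ∷ [])     = 0
  ascList (x ∷ y ∷ xs) = (if (x % m) <ᵇ (y % m) then 1 else 0) + ascList (y ∷ xs)

  asc : List ℕ → ℕ
  asc = ascList

  inD : List ℕ → Bool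
  inD la = Data.List.foldr (λ x b → (countᵇ (λ y → y ≡ᵇ x) la ≤ᵇ (m ∸ 1)) ∧ b) true la

  inO : List ℕ → Bool
  inO la = Data.List.foldr (λ x b → not ((x % m) ≡ᵇ 0) ∧ b) true la

  lhsExp : List ℕ → Vec ℤ m
  lhsExp μ = tabulate (λ (i : Fin m) → + sᵢ (suc (toℕ i)) μ)

  rhsExp : List ℕ → Vec ℤ m
  rhsExp la = tabulate (λ (i : Fin m) →
    if suc (toℕ i) <ᵇ m then + ℓᵢ (suc (toℕ i)) la
    else (+ (part la 1 / m)) ℤ.- (+ asc la))

  lhsCoeff : ℕ → Vec ℤ m → ℕ
  lhsCoeff n e = countᵇ (λ μ → inD μ ∧ ⌊ vec-≡-dec _≟ℤ_ (lhsExp μ) e ⌋) (partitions n)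

  rhsCoeff : ℕ → Vec ℤ m → ℕ
  rhsCoeff n e = countᵇ (λ la → inO la ∧ ⌊ vec-≡-dec _≟ℤ_ (rhsExp la) e ⌋) (partitions n)

{-# OPTIONS --safe #-}

-- Conjugation turns μ ∈ D_m into a partition whose successive differences (last part included)
-- are smaller than m. Such a partition is determined by the word of the residues of its parts,
-- which is any word not ending in 0, and s_i(μ) counts the letters i (s_m(μ): the letters 0).
-- A partition λ ∈ O_m amounts to the word v of the residues of its parts, all nonzero, and
-- a partition π with at most as many parts, added m-fold to the smallest partition with residues v;
-- the largest part of π is ⌊λ₁/m⌋ − asc(λ).
-- It remains to match the insertions of s zeros into v, none after the last letter, with the
-- partitions π with largest part s, in such a way that the sum of the positions of the ascents
-- grows by |π|; this matching is built letter by letter.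
module Submission where

open import Defs
open import Data.Bool using (Bool; true; false; if_then_else_; T; not; _∧_)
open import Data.Bool.Properties using (T?; T-∧)
open import Data.Empty using (⊥-elim)
open import Data.Fin.Properties using (toℕ<n)
open import Data.Integer using (ℤ)
open import Data.List using (List; []; _∷_; _++_; length; map; replicate; reverse; _ʳ++_; take; upTo; filterᵇ; foldr)
open import Data.List.Membership.Propositional using (_∈_; lose; find)
open import Data.List.Membership.Propositional.Properties
open import Data.List.Properties
  using (length-++; length-replicate; length-map; ∷-injective; ∷-injectiveʳ; filter-++; ++-cancelˡ;
         map-applyUpTo; map-cong; reverse-involutive; reverse-injective)
open import Data.List.Relation.Unary.All as All using (All; []; _∷_)
open import Data.List.Relation.Unary.AllPairs using ([]; _∷_)
open import Data.List.Relation.Unary.Any using (here; there)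
open import Data.List.Relation.Unary.Unique.Propositional using (Unique)
open import Data.Nat
open import Data.Nat.DivMod
open import Data.Nat.ListAction using (sum)
open import Data.Nat.ListAction.Properties using (sum-++)
open import Data.Nat.Properties
open import Data.Nat.Tactic.RingSolver using (solve-∀)
open import Data.List.Membership.DecPropositional _≟_ using (_∈?_)
open import Data.Product using (Σ; ∃; ∃₂; _×_; _,_; proj₁; proj₂)
open import Data.Sum using (inj₁; inj₂)
open import Data.Unit using (tt)
open import Data.Vec as Vec using (Vec; []; _∷_; _∷ʳ_; toList)
open import Data.Vec.Properties using (∷ʳ-injective; length-toList; tabulate-cong)
open import Function using (_∘_; id)
open import Function.Bundles using (Equivalence)
open import Relation.Binary.PropositionalEquality
open import Relation.Nullary using (¬_; yes; no)
open import Relation.Nullary.Decidable using (toWitness; fromWitness)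
open import Relation.Nullary.Reflects using (ofʸ; ofⁿ)
import Data.Integer.Properties as ℤ
import Data.Integer as ℤ
import Data.List.Relation.Unary.All.Properties as All
import Data.List.Relation.Unary.AllPairs as AllPairs
import Data.List.Relation.Unary.AllPairs.Properties as AllPairs
import Data.List.Relation.Unary.Unique.Propositional.Properties as Unique
import Data.Vec.Properties as Vec

-- Enumeration of partitions

-- The matching is a relation and not a function, so that one correspondence between partitions
-- serves for both inequalities. The induction removes a partner `y` of the head from `ys`, which
-- costs the other elements none of their own partners.
length-≤-matching : ∀ {A B : Set} (R : A → B → Set) (xs : List A) (ys : List B) → Unique xs →
  (∀ {x} → x ∈ xs → ∃ λ y → y ∈ ys × R x y) →
  (∀ {x x′ y} → R x y → R x′ y → x ≡ x′) →
  length xs ≤ length ys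
length-≤-matching R [] ys _ _ _ = z≤n
length-≤-matching R (x ∷ xs) ys (x# ∷ u) total inj with total (here refl)
... | y , y∈ys , xRy with ∈-∃++ y∈ys
... | as , bs , refl = begin
  suc (length xs)             ≤⟨ s≤s (length-≤-matching R xs (as ++ bs) u total′ inj) ⟩
  suc (length (as ++ bs))     ≡⟨ cong suc (length-++ as) ⟩
  suc (length as + length bs) ≡⟨ +-suc (length as) (length bs) ⟨
  length as + suc (length bs) ≡⟨ length-++ as ⟨
  length (as ++ y ∷ bs)       ∎
  where
  open ≤-Reasoning
  total′ : ∀ {x′} → x′ ∈ xs → ∃ λ y′ → y′ ∈ as ++ bs × R x′ y′
  total′ x′∈ with total (there x′∈)
  ... | y′ , y′∈ , x′Ry′ with ∈-++⁻ as y′∈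
  ... | inj₁ p = y′ , ∈-++⁺ˡ p , x′Ry′
  ... | inj₂ (there p) = y′ , ∈-++⁺ʳ as p , x′Ry′
  -- If the partner of `x′` were the removed `y`, then `x` would equal `x′` and occur twice.
  ... | inj₂ (here refl) = ⊥-elim (All.lookup x# x′∈ (inj xRy x′Ry′))

data Partition : ℕ → List ℕ → Set where
  []   : ∀ {k} → Partition k []
  cons : ∀ {j k js} → 1 ≤ j → j ≤ k → Partition j js → Partition k (j ∷ js)

-- This allows any bound on the parts to be replaced by the size, which is the bound used in
-- `partitions`.
Partition-≤sum : ∀ {k la} → Partition k la → Partition (sum la) la
Partition-≤sum [] = []
Partition-≤sum (cons 1≤j _ p) = cons 1≤j (m≤m+n _ _) p

∈-ptns⁺ : ∀ f {n k la} → Partition k la → sum la ≡ n → n ≤ f → la ∈ ptns f n k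
∈-ptns⁺ zero [] refl n≤f = here refl
∈-ptns⁺ (suc f) [] refl n≤f = here refl
∈-ptns⁺ zero (cons {suc j} 1≤j j≤k p) refl ()
∈-ptns⁺ (suc f) {k = k} (cons {suc j} {js = js} 1≤j j≤k p) refl (s≤s n≤f) =
  ∈-concatMap⁺ _ (lose
    (∈-filter⁺ (T? ∘ (_≤ᵇ k)) (∈-map⁺ suc (∈-upTo⁺ (s≤s (m≤m+n j _)))) (≤⇒≤ᵇ j≤k))
    (∈-map⁺ (suc j ∷_) (∈-ptns⁺ f p (sym (m+n∸m≡n j _)) (≤-trans (m∸n≤m _ j) n≤f))))

∈-ptns⁻ : ∀ f n k {la} → la ∈ ptns f n k → Partition k la × sum la ≡ n
∈-ptns⁻ zero zero k (here refl) = [] , refl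
∈-ptns⁻ (suc f) zero k (here refl) = [] , refl
∈-ptns⁻ (suc f) (suc n) k la∈
  with find (∈-concatMap⁻ (λ j → map (j ∷_) (ptns f (suc n ∸ j) j))
                           {filterᵇ (_≤ᵇ k) (map suc (upTo (suc n)))} la∈)
... | j , j∈ , la∈′ with ∈-filter⁻ (T? ∘ (_≤ᵇ k)) {xs = map suc (upTo (suc n))} j∈ | ∈-map⁻ (j ∷_) la∈′
... | j∈′ , j≤k | js , js∈ , refl with ∈-map⁻ suc j∈′ | ∈-ptns⁻ f (suc n ∸ j) j js∈
... | i , i∈ , refl | p , Σ≡ =
  cons (s≤s z≤n) (≤ᵇ⇒≤ (suc i) k j≤k) p ,
  trans (cong (suc i +_) Σ≡) (m+[n∸m]≡n (∈-upTo⁻ i∈))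

ptns-unique : ∀ f n k → Unique (ptns f n k)
ptns-unique zero zero k = [] ∷ []
ptns-unique zero (suc n) k = []
ptns-unique (suc f) zero k = [] ∷ []
ptns-unique (suc f) (suc n) k = Unique.concat⁺
  (All.map⁺ (All.universal (λ j → Unique.map⁺ ∷-injectiveʳ (ptns-unique f (suc n ∸ j) j)) js))
  (AllPairs.map⁺ (AllPairs.map disjoint
    (Unique.filter⁺ (T? ∘ (_≤ᵇ k)) (Unique.map⁺ suc-injective (Unique.upTo⁺ (suc n))))))
  where
  js = filterᵇ (_≤ᵇ k) (map suc (upTo (suc n)))
  disjoint : ∀ {i j xss yss} → i ≢ j → ∀ {la} → la ∈ map (i ∷_) xss × la ∈ map (j ∷_) yss → _
  disjoint {i} {j} i≢j (p , q) with ∈-map⁻ (i ∷_) p | ∈-map⁻ (j ∷_) q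
  ... | _ , _ , refl | _ , _ , eq = i≢j (proj₁ (∷-injective eq))

countᵇ-partitions-≤ : (p q : List ℕ → Bool) (R : List ℕ → List ℕ → Set) (n : ℕ) →
  (∀ {μ} → Partition n μ → sum μ ≡ n → T (p μ) →
     ∃ λ la → (∃ λ k → Partition k la) × sum la ≡ n × T (q la) × R μ la) →
  (∀ {μ μ′ la} → R μ la → R μ′ la → μ ≡ μ′) →
  countᵇ p (partitions n) ≤ countᵇ q (partitions n)
countᵇ-partitions-≤ p q R n total inj =
  length-≤-matching R (filterᵇ p (partitions n)) (filterᵇ q (partitions n))
    (Unique.filter⁺ (T? ∘ p) (ptns-unique n n n)) total′ inj
  where
  total′ : ∀ {μ} → μ ∈ filterᵇ p (partitions n) → ∃ λ la → la ∈ filterᵇ q (partitions n) × R μ la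
  total′ μ∈ with ∈-filter⁻ (T? ∘ p) {xs = partitions n} μ∈
  ... | μ∈′ , pμ with ∈-ptns⁻ n n n μ∈′
  ... | ptn , Σ≡ with total ptn Σ≡ pμ
  ... | la , (k , ptn′) , Σ≡′ , qla , r =
    la , ∈-filter⁺ (T? ∘ q) (∈-ptns⁺ n (subst (λ s → Partition s la) Σ≡′ (Partition-≤sum ptn′)) Σ≡′ ≤-refl) qla , r

-- Inserting zeros into a word

bit : Bool → ℕ
bit b = if b then 1 else 0

zipPairs : ∀ {n} → Vec ℕ n → Vec ℕ n → List (ℕ × ℕ)
zipPairs [] [] = []
zipPairs (x ∷ xs) (y ∷ ys) = (x , y) ∷ zipPairs xs ys

-- Words are read from right to left, and (k , b) is a letter b preceded by k zeros.
expand : List (ℕ × ℕ) → List ℕ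
expand [] = []
expand ((k , b) ∷ zs) = b ∷ replicate k 0 ++ expand zs

-- The positions i with wᵢ < wᵢ₊₁ in the unreversed word, summed; a is the letter to the right of w.
maj : ℕ → List ℕ → ℕ
maj a [] = 0
maj a (b ∷ w) = bit (b <ᵇ a) * suc (length w) + maj b w

-- ds lists the successive differences of a partition π, starting from its smallest part
-- (possibly 0), so that weight ds = |π| and the sum of ds is the largest part of π.
weight : ∀ {n} → Vec ℕ n → ℕ
weight [] = 0
weight {suc n} (d ∷ ds) = d * suc n + weight ds

-- π is extended by the letter b with k zeros before it, s being the number of zeros to the left of b.
-- If b makes an ascent with the next letter to its left, or is the leftmost letter, then s
-- becomes a new largest part. Otherwise, if k = 0, a smallest part 0 is added, and if k > 0,
-- all parts grow by one before s is added. The third clause is never reached from insertZeros.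
step : ∀ {n} → Bool → ℕ → Vec ℕ n → Vec ℕ (suc n)
step true k ds = ds ∷ʳ k
step false zero ds = 0 ∷ ds
step false (suc k) [] = suc k ∷ []
step false (suc k) (d ∷ ds) = suc d ∷ (ds ∷ʳ k)

headBelow : ∀ {n} → ℕ → Vec ℕ n → Bool
headBelow b [] = true
headBelow b (a ∷ _) = a <ᵇ b

-- Both vectors start with the last letter, so the recursion treats the leftmost letter first. Each
-- letter contributes one part of π, possibly 0, so π has at most `n` nonzero parts.
insertZeros : ∀ {n} → Vec ℕ n → Vec ℕ n → Vec ℕ n
insertZeros [] [] = []
insertZeros (b ∷ bs) (k ∷ ks) = step (headBelow b bs) k (insertZeros bs ks)

sum-∷ʳ : ∀ {n} k (ds : Vec ℕ n) → Vec.sum (ds ∷ʳ k) ≡ Vec.sum ds + k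
sum-∷ʳ k [] = +-comm k 0
sum-∷ʳ k (d ∷ ds) = trans (cong (d +_) (sum-∷ʳ k ds)) (sym (+-assoc d _ k))

-- For `false`, the first entry of the result is 0 exactly when `k = 0`. Once the clause is known,
-- `k` can be read off the last entry. The inverse in `step-surjective` is found in the same way.
step-injective : ∀ {n} f {k k′} (ds ds′ : Vec ℕ n) → step f k ds ≡ step f k′ ds′ → k ≡ k′ × ds ≡ ds′
step-injective true ds ds′ eq with ∷ʳ-injective ds ds′ eq
... | eq₁ , eq₂ = eq₂ , eq₁
step-injective false {zero} {zero} ds ds′ eq = refl , proj₂ (Vec.∷-injective eq)
step-injective false {zero} {suc k′} ds [] ()
step-injective false {zero} {suc k′} ds (d ∷ ds′) ()
step-injective false {suc k} {zero} [] ds′ ()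
step-injective false {suc k} {zero} (d ∷ ds) ds′ ()
step-injective false {suc k} {suc k′} [] [] refl = refl , refl
step-injective false {suc k} {suc k′} (d ∷ ds) (d′ ∷ ds′) eq with Vec.∷-injective eq
... | refl , eq′ with ∷ʳ-injective ds ds′ eq′
... | refl , refl = refl , refl

step-surjective : ∀ {n} f (es : Vec ℕ (suc n)) → ∃ λ k → ∃ λ ds → step f k ds ≡ es
step-surjective true es with Vec.initLast es
... | ds , k , eq = k , ds , sym eq
step-surjective false (zero ∷ ds) = 0 , ds , refl
step-surjective false (suc d ∷ []) = suc d , [] , refl
step-surjective false (suc d ∷ es@(_ ∷ _)) with Vec.initLast es
... | ds , k , eq = suc k , d ∷ ds , cong (suc d ∷_) (sym eq)

insertZeros-injective : ∀ {n} (bs ks ks′ : Vec ℕ n) → insertZeros bs ks ≡ insertZeros bs ks′ → ks ≡ ks′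
insertZeros-injective [] [] [] eq = refl
insertZeros-injective (b ∷ bs) (k ∷ ks) (k′ ∷ ks′) eq with step-injective (headBelow b bs) _ _ eq
... | refl , eq′ = cong (k ∷_) (insertZeros-injective bs ks ks′ eq′)

insertZeros-surjective : ∀ {n} (bs ds : Vec ℕ n) → ∃ λ ks → insertZeros bs ks ≡ ds
insertZeros-surjective [] [] = [] , refl
insertZeros-surjective (b ∷ bs) es with step-surjective (headBelow b bs) es
... | k , ds , refl with insertZeros-surjective bs ds
... | ks , refl = k ∷ ks , refl

sum-step : ∀ {n} f k (ds : Vec ℕ n) → Vec.sum (step f k ds) ≡ k + Vec.sum ds
sum-step true k ds = trans (sum-∷ʳ k ds) (+-comm _ k)
sum-step false zero ds = refl
sum-step false (suc k) [] = refl
sum-step false (suc k) (d ∷ ds) = cong suc (trans (cong (d +_) (sum-∷ʳ k ds)) (lemma d (Vec.sum ds) k))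
  where
  lemma : ∀ d s k → d + (s + k) ≡ k + (d + s)
  lemma = solve-∀

-- This makes the number of zeros the largest part of π, which `asc-toRegular` identifies with the
-- exponent of `z_m`.
sum-insertZeros : ∀ {n} (bs ks : Vec ℕ n) → Vec.sum (insertZeros bs ks) ≡ Vec.sum ks
sum-insertZeros [] [] = refl
sum-insertZeros (b ∷ bs) (k ∷ ks) =
  trans (sum-step (headBelow b bs) k (insertZeros bs ks)) (cong (k +_) (sum-insertZeros bs ks))

-- A difference appended at the end creates a new largest part `Vec.sum ds + k` and leaves the other
-- parts alone.
weight-∷ʳ : ∀ {n} k (ds : Vec ℕ n) → weight (ds ∷ʳ k) ≡ weight ds + (Vec.sum ds + k)
weight-∷ʳ k [] = trans (+-identityʳ _) (*-identityʳ k)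
weight-∷ʳ {suc n} k (d ∷ ds) = trans (cong (d * suc (suc n) +_) (weight-∷ʳ k ds)) (lemma d n (weight ds) (Vec.sum ds) k)
  where
  lemma : ∀ d n w s k → d * suc (suc n) + (w + (s + k)) ≡ d * suc n + w + (d + s + k)
  lemma = solve-∀

length-expand : ∀ {n} (ks bs : Vec ℕ n) → length (expand (zipPairs ks bs)) ≡ n + Vec.sum ks
length-expand [] [] = refl
length-expand {suc n} (k ∷ ks) (b ∷ bs) = cong suc (begin
  length (replicate k 0 ++ expand (zipPairs ks bs))
    ≡⟨ length-++ (replicate k 0) ⟩
  length (replicate k 0) + length (expand (zipPairs ks bs))
    ≡⟨ cong₂ _+_ (length-replicate k) (length-expand ks bs) ⟩
  k + (n + Vec.sum ks)
    ≡⟨ lemma k n (Vec.sum ks) ⟩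
  n + (k + Vec.sum ks) ∎)
  where
  open ≡-Reasoning
  lemma : ∀ k n s → k + (n + s) ≡ n + (k + s)
  lemma = solve-∀

maj-zeros : ∀ k w → maj 0 (replicate k 0 ++ w) ≡ maj 0 w
maj-zeros zero w = refl
maj-zeros (suc k) w = maj-zeros k w

-- Only the zero next to `b` makes an ascent with its right neighbour, at position
-- `suc k + length w`; no letter of `w` can make an ascent into a zero.
maj-positive-zeros : ∀ {b} k w → 0 < b → maj b (replicate (suc k) 0 ++ w) ≡ suc k + length w + maj 0 w
maj-positive-zeros {suc b} k w _ = cong₂ _+_
  (trans (*-identityˡ _) (cong suc (trans (length-++ (replicate k 0)) (cong (_+ length w) (length-replicate k)))))
  (maj-zeros k w)

-- The position of the ascent into a positive letter, or 0 if there is none, when `L` letters and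
-- then `k` zeros precede it. Any zero forces an ascent; without zeros, `f` decides.
majHead : Bool → ℕ → ℕ → ℕ
majHead f zero L = bit f * L
majHead f (suc k) L = suc k + L

maj-zeros-++ : ∀ {a b} k w → 0 < b →
  maj b (replicate k 0 ++ a ∷ w) ≡ majHead (a <ᵇ b) k (suc (length w)) + maj 0 (a ∷ w)
maj-zeros-++ zero w _ = refl
maj-zeros-++ {a} (suc k) w 0<b = maj-positive-zeros k (a ∷ w) 0<b

-- The clauses of `step` are designed for this identity. Let `s = k + Vec.sum ds` be the number of
-- zeros left of the new letter, which has `suc n` nonzero letters to its left. If `f` is true, its
-- ascent moves from position `suc n` to `suc n + s`, and the gain is the new part `s`. If `f` is
-- false and `k > 0`, a new ascent arises at `suc n + s`: the `suc n` old parts grow by one each,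
-- and `s` is added as a part.
weight-step : ∀ {n} f k (ds : Vec ℕ (suc n)) v →
  majHead f k (suc n + Vec.sum ds) + (weight ds + v) ≡ weight (step f k ds) + (bit f * suc n + v)
weight-step {n} true zero ds v =
  trans (lemma n (Vec.sum ds) (weight ds) v) (cong (_+ (1 * suc n + v)) (sym (weight-∷ʳ 0 ds)))
  where
  lemma : ∀ n s d v → 1 * (suc n + s) + (d + v) ≡ d + (s + 0) + (1 * suc n + v)
  lemma = solve-∀
weight-step {n} true (suc k) ds v =
  trans (lemma k n (Vec.sum ds) (weight ds) v) (cong (_+ (1 * suc n + v)) (sym (weight-∷ʳ (suc k) ds)))
  where
  lemma : ∀ k n s d v → suc k + (suc n + s) + (d + v) ≡ d + (s + suc k) + (1 * suc n + v)
  lemma = solve-∀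
weight-step false zero ds v = refl
weight-step {n} false (suc k) (d ∷ ds) v =
  trans (lemma k n d (Vec.sum ds) (weight ds) v)
        (cong (λ x → suc d * suc (suc n) + x + v) (sym (weight-∷ʳ k ds)))
  where
  lemma : ∀ k n d s w v → suc k + (suc n + (d + s)) + (d * suc n + w + v)
                        ≡ suc d * suc (suc n) + (w + (s + k)) + v
  lemma = solve-∀

maj-insertZeros : ∀ {n} (bs ks : Vec ℕ n) → All (0 <_) (toList bs) →
  maj 0 (expand (zipPairs ks bs)) ≡ weight (insertZeros bs ks) + maj 0 (toList bs)
maj-insertZeros [] [] [] = refl
maj-insertZeros (suc b ∷ []) (zero ∷ []) (_ ∷ []) = refl
maj-insertZeros (b ∷ []) (suc k ∷ []) (b>0 ∷ []) =
  trans (maj-positive-zeros k [] b>0) (lemma k)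
  where
  lemma : ∀ k → suc k + 0 + 0 ≡ suc k * 1 + 0 + 0
  lemma = solve-∀
maj-insertZeros {suc (suc n)} (b ∷ bs@(a ∷ bs′)) (k ∷ ks@(k′ ∷ ks′)) (b>0 ∷ bs>0) = begin
  maj b (replicate k 0 ++ a ∷ w)
    ≡⟨ maj-zeros-++ k w b>0 ⟩
  majHead f k (suc (length w)) + maj 0 (a ∷ w)
    ≡⟨ cong₂ (λ l v → majHead f k l + v) (length-expand ks bs) (maj-insertZeros bs ks bs>0) ⟩
  majHead f k (suc n + Vec.sum ks) + (weight ds + maj 0 (toList bs))
    ≡⟨ cong (λ s → majHead f k (suc n + s) + (weight ds + maj 0 (toList bs))) (sum-insertZeros bs ks) ⟨
  majHead f k (suc n + Vec.sum ds) + (weight ds + maj 0 (toList bs))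
    ≡⟨ weight-step f k ds (maj 0 (toList bs)) ⟩
  weight (step f k ds) + (bit f * suc n + maj a (toList bs′))
    ≡⟨ cong (λ l → weight (step f k ds) + (bit f * suc l + maj a (toList bs′))) (length-toList bs′) ⟨
  weight (step f k ds) + maj b (toList bs) ∎
  where
  open ≡-Reasoning
  f = a <ᵇ b
  w = replicate k′ 0 ++ expand (zipPairs ks′ bs′)
  ds = insertZeros bs ks

-- Increasing lists and residues

data Increasing : ℕ → List ℕ → Set where
  []   : ∀ {p} → Increasing p []
  cons : ∀ {p x xs} → p ≤ x → Increasing x xs → Increasing p (x ∷ xs)

countᵇ-∷ : ∀ {A : Set} (p : A → Bool) x xs → countᵇ p (x ∷ xs) ≡ bit (p x) + countᵇ p xs
countᵇ-∷ p x xs with p x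
... | true = refl
... | false = refl

countᵇ-ʳ++ : ∀ {A : Set} (p : A → Bool) xs ys → countᵇ p (xs ʳ++ ys) ≡ countᵇ p xs + countᵇ p ys
countᵇ-ʳ++ p [] ys = refl
countᵇ-ʳ++ p (x ∷ xs) ys = begin
  countᵇ p (xs ʳ++ x ∷ ys)
    ≡⟨ countᵇ-ʳ++ p xs (x ∷ ys) ⟩
  countᵇ p xs + countᵇ p (x ∷ ys)
    ≡⟨ cong (countᵇ p xs +_) (countᵇ-∷ p x ys) ⟩
  countᵇ p xs + (bit (p x) + countᵇ p ys)
    ≡⟨ lemma (countᵇ p xs) (bit (p x)) (countᵇ p ys) ⟩
  bit (p x) + countᵇ p xs + countᵇ p ys
    ≡⟨ cong (_+ countᵇ p ys) (countᵇ-∷ p x xs) ⟨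
  countᵇ p (x ∷ xs) + countᵇ p ys ∎
  where
  open ≡-Reasoning
  lemma : ∀ a b c → a + (b + c) ≡ b + a + c
  lemma = solve-∀

sum-ʳ++ : ∀ xs ys → sum (xs ʳ++ ys) ≡ sum xs + sum ys
sum-ʳ++ [] ys = refl
sum-ʳ++ (x ∷ xs) ys = trans (sum-ʳ++ xs (x ∷ ys)) (lemma (sum xs) x (sum ys))
  where
  lemma : ∀ a b c → a + (b + c) ≡ b + a + c
  lemma = solve-∀

flat : List ℕ → List (ℕ × ℕ)
flat = map (0 ,_)

length-zipPairs : ∀ {n} (ds bs : Vec ℕ n) → length (zipPairs ds bs) ≡ n
length-zipPairs [] [] = refl
length-zipPairs (_ ∷ ds) (_ ∷ bs) = cong suc (length-zipPairs ds bs)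

-- For letters below `m`, the smallest number that is at least `a + q * m` and congruent to `b` is
-- `b + (carry a b + q) * m`. The same bit records an ascent from `b` to `a` in `maj` and in `asc`.
carry : ℕ → ℕ → ℕ
carry a b = bit (b <ᵇ a)

module _ (m : ℕ) .{{_ : NonZero m}} where

  remainder-unique : ∀ b q → b < m → (b + q * m) % m ≡ b
  remainder-unique b q b<m = trans ([m+kn]%n≡m%n b q m) (m<n⇒m%n≡m b<m)

  quotient-unique : ∀ b q → b < m → (b + q * m) / m ≡ q
  quotient-unique b q b<m = *-cancelʳ-≡ _ _ m (+-cancelˡ-≡ b _ _ (begin
    b + (b + q * m) / m * m
      ≡⟨ cong (_+ (b + q * m) / m * m) (remainder-unique b q b<m) ⟨
    (b + q * m) % m + (b + q * m) / m * m
      ≡⟨ m≡m%n+[m/n]*n (b + q * m) m ⟨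
    b + q * m ∎))
    where open ≡-Reasoning

  divide-unique : ∀ {b b′ q q′} → b < m → b′ < m → b + q * m ≡ b′ + q′ * m → b ≡ b′ × q ≡ q′
  divide-unique {b} {b′} {q} {q′} b<m b′<m eq =
    trans (sym (remainder-unique b q b<m)) (trans (cong (_% m) eq) (remainder-unique b′ q′ b′<m)) ,
    trans (sym (quotient-unique b q b<m)) (trans (cong (_/ m) eq) (quotient-unique b′ q′ b′<m))

  -- The four `carry` lemmas translate conditions on consecutive parts into conditions on their
  -- quotients: being nondecreasing means `carry a b + q ≤ q′`, and a difference below `m` means
  -- `q′ ≤ carry a b + q`. Under both conditions the residue determines the next part.
  carry-≤⁺ : ∀ {a b} q q′ → a < m → carry a b + q ≤ q′ → a + q * m ≤ b + q′ * m
  carry-≤⁺ {a} {b} q q′ a<m le with b <ᵇ a | <ᵇ-reflects-< b a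
  ... | true | _ = ≤-trans (+-monoˡ-≤ (q * m) (<⇒≤ a<m)) (≤-trans (*-monoˡ-≤ m le) (m≤n+m _ b))
  ... | false | ofⁿ b≮a = +-mono-≤ (≮⇒≥ b≮a) (*-monoˡ-≤ m le)

  carry-≤⁻ : ∀ {a b} q q′ → b < m → a + q * m ≤ b + q′ * m → carry a b + q ≤ q′
  carry-≤⁻ {a} {b} q q′ b<m le with b <ᵇ a | <ᵇ-reflects-< b a
  ... | true | ofʸ b<a = ≰⇒> λ q′≤q →
    <⇒≱ (+-mono-<-≤ b<a (*-monoˡ-≤ m q′≤q)) le
  ... | false | _ = ≮⇒≥ λ q′<q →
    <⇒≱ (<-≤-trans (+-monoˡ-< (q′ * m) b<m) (≤-trans (*-monoˡ-≤ m q′<q) (m≤n+m _ a))) le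

  carry-<⁺ : ∀ {a b} q → b < m → b + (carry a b + q) * m < a + q * m + m
  carry-<⁺ {a} {b} q b<m with b <ᵇ a | <ᵇ-reflects-< b a
  ... | true | ofʸ b<a = ≤-trans (+-monoˡ-≤ (m + q * m) b<a) (≤-reflexive (lemma a m (q * m)))
    where
    lemma : ∀ a m x → a + (m + x) ≡ a + x + m
    lemma = solve-∀
  ... | false | _ = ≤-trans (+-monoˡ-< (q * m) b<m)
                      (≤-trans (≤-reflexive (+-comm m (q * m))) (+-monoˡ-≤ m (m≤n+m (q * m) a)))

  carry-<⁻ : ∀ {a b} q q′ → a < m → b + q′ * m < a + q * m + m → q′ ≤ carry a b + q
  carry-<⁻ {a} {b} q q′ a<m lt with b <ᵇ a | <ᵇ-reflects-< b a
  ... | true | _ = ≮⇒≥ λ 1+q<q′ → <⇒≱ lt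
    (≤-trans (+-monoˡ-≤ m (+-monoˡ-≤ (q * m) (<⇒≤ a<m)))
      (≤-trans (≤-reflexive (+-comm (m + q * m) m))
        (≤-trans (*-monoˡ-≤ m 1+q<q′) (m≤n+m _ b))))
  ... | false | ofⁿ b≮a = ≮⇒≥ λ q<q′ → <⇒≱ lt
    (≤-trans (≤-reflexive (lemma a m (q * m))) (+-mono-≤ (≮⇒≥ b≮a) (*-monoˡ-≤ m q<q′)))
    where
    lemma : ∀ a m x → a + x + m ≡ a + (m + x)
    lemma = solve-∀

  -- With `p = 0` these are, smallest part first and up to parts 0, the conjugates of the partitions
  -- in `D_m`: the differences become multiplicities.
  data Flat : ℕ → List ℕ → Set where
    []   : ∀ {p} → Flat p []
    cons : ∀ {p x xs} → p ≤ x → x < p + m → Flat x xs → Flat p (x ∷ xs)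

  -- After a part a + q * m, the pair (d , b) asks for the d-th (from 0) possible part that is
  -- congruent to b.
  rows : ℕ → ℕ → List (ℕ × ℕ) → List ℕ
  rows q a [] = []
  rows q a ((d , b) ∷ zs) = b + (d + (carry a b + q)) * m ∷ rows (d + (carry a b + q)) b zs

  Bounded : List ℕ → Set
  Bounded = All (_< m)

  rows-increasing : ∀ q a zs → a < m → Bounded (map proj₂ zs) → Increasing (a + q * m) (rows q a zs)
  rows-increasing q a [] a<m [] = []
  rows-increasing q a ((d , b) ∷ zs) a<m (b<m ∷ bs<m) =
    cons (carry-≤⁺ q _ a<m (m≤n+m _ d)) (rows-increasing _ b zs b<m bs<m)

  rows-flat : ∀ q a w → a < m → Bounded w → Flat (a + q * m) (rows q a (flat w))
  rows-flat q a [] a<m [] = []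
  rows-flat q a (b ∷ w) a<m (b<m ∷ bs<m) =
    cons (carry-≤⁺ q _ a<m ≤-refl) (carry-<⁺ {a} q b<m) (rows-flat _ b w b<m bs<m)

  rows-injective : ∀ q a zs zs′ → Bounded (map proj₂ zs) → Bounded (map proj₂ zs′) →
    rows q a zs ≡ rows q a zs′ → zs ≡ zs′
  rows-injective q a [] [] _ _ _ = refl
  rows-injective q a ((d , b) ∷ zs) ((d′ , b′) ∷ zs′) (b<m ∷ bs) (b′<m ∷ bs′) eq
    with ∷-injective eq
  ... | eq₁ , eq₂
    with divide-unique {q = d + (carry a b + q)} {q′ = d′ + (carry a b′ + q)} b<m b′<m eq₁
  ... | refl , eq₃ with +-cancelʳ-≡ (carry a b + q) d d′ eq₃
  ... | refl = cong ((d , b) ∷_) (rows-injective _ b zs zs′ bs bs′ eq₂)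

  divide : ∀ x → ∃₂ λ b q → b < m × x ≡ b + q * m
  divide x = x % m , x / m , m%n<n x m , m≡m%n+[m/n]*n x m

  rows-surjective : ∀ q a xs → a < m → Increasing (a + q * m) xs →
    ∃ λ zs → Bounded (map proj₂ zs) × rows q a zs ≡ xs
  rows-surjective q a [] a<m [] = [] , [] , refl
  rows-surjective q a (x ∷ xs) a<m (cons p≤x inc) with divide x
  ... | b , q′ , b<m , refl with carry-≤⁻ q q′ b<m p≤x | rows-surjective q′ b xs b<m inc
  ... | c≤ | zs , bs<m , eq =
    (q′ ∸ (carry a b + q) , b) ∷ zs , b<m ∷ bs<m ,
    subst (λ r → b + r * m ∷ rows r b zs ≡ b + q′ * m ∷ xs)
      (sym (m∸n+n≡m c≤)) (cong (b + q′ * m ∷_) eq)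

  rows-flat-surjective : ∀ q a xs → a < m → Flat (a + q * m) xs →
    ∃ λ w → Bounded w × rows q a (flat w) ≡ xs
  rows-flat-surjective q a [] a<m [] = [] , [] , refl
  rows-flat-surjective q a (x ∷ xs) a<m (cons p≤x x< fl) with divide x
  ... | b , q′ , b<m , refl
    with ≤-antisym (carry-≤⁻ q q′ b<m p≤x) (carry-<⁻ {b = b} q q′ a<m x<)
       | rows-flat-surjective q′ b xs b<m fl
  ... | refl | w , w<m , eq = b ∷ w , b<m ∷ w<m , cong (b + q′ * m ∷_) eq

  -- An increase of the quotient persists in all later rows, hence the factor `suc (length zs)`.
  rowWeight : ℕ → List (ℕ × ℕ) → ℕ
  rowWeight a [] = 0
  rowWeight a ((d , b) ∷ zs) = (d + carry a b) * suc (length zs) + rowWeight b zs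

  sum-rows : ∀ q a zs →
    sum (rows q a zs) ≡ sum (map proj₂ zs) + m * (q * length zs + rowWeight a zs)
  sum-rows q a [] = sym (trans (cong (m *_) (trans (+-identityʳ _) (*-zeroʳ q))) (*-zeroʳ m))
  sum-rows q a ((d , b) ∷ zs) =
    trans (cong (b + (d + (carry a b + q)) * m +_) (sum-rows _ b zs))
          (lemma b d (carry a b) q m (sum (map proj₂ zs)) (length zs) (rowWeight b zs))
    where
    lemma : ∀ b d c q m s l r → b + (d + (c + q)) * m + (s + m * ((d + (c + q)) * l + r))
                              ≡ b + s + m * (q * suc l + ((d + c) * suc l + r))
    lemma = solve-∀

  -- In minimal rows the quotient grows only by carries. These are the ascents of the word, and the
  -- number of rows affected by a carry is the position of the ascent.
  rowWeight-flat : ∀ a w → rowWeight a (flat w) ≡ maj a w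
  rowWeight-flat a [] = refl
  rowWeight-flat a (b ∷ w) = cong₂ (λ l r → carry a b * suc l + r) (length-map {B = ℕ × ℕ} (0 ,_) w) (rowWeight-flat b w)

  -- The two summands come from π and from the smallest partition with residues `bs`.
  rowWeight-zipPairs : ∀ {n} a (ds bs : Vec ℕ n) →
    rowWeight a (zipPairs ds bs) ≡ weight ds + maj a (toList bs)
  rowWeight-zipPairs a [] [] = refl
  rowWeight-zipPairs {suc n} a (d ∷ ds) (b ∷ bs) rewrite rowWeight-zipPairs b ds bs
    | length-zipPairs ds bs | length-toList bs = lemma d (carry a b) n (weight ds) (maj b (toList bs))
    where
    lemma : ∀ d c n w v → (d + c) * suc n + (w + v) ≡ d * suc n + w + (c * suc n + v)
    lemma = solve-∀

  -- From row to row the quotient grows by `d` plus the carry, and the carry is an ascent of the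
  -- reversed list. Ascents already present in the accumulator occur on both sides.
  asc-rows : ∀ q a zs acc → a < m → Bounded (map proj₂ zs) →
    part (rows q a zs ʳ++ a + q * m ∷ acc) 1 / m + asc m (a + q * m ∷ acc)
      ≡ sum (map proj₁ zs) + q + asc m (rows q a zs ʳ++ a + q * m ∷ acc)
  asc-rows q a [] acc a<m [] = cong (_+ asc m (a + q * m ∷ acc)) (quotient-unique a q a<m)
  -- In the induction hypothesis the carry appears on the left as the ascent from `x` to `p` and on
  -- the right inside the quotient `q′`; adding it to both sides of the goal gives the same shape.
  asc-rows q a ((d , b) ∷ zs) acc a<m (b<m ∷ bs<m) = +-cancelˡ-≡ (carry a b) _ _ (begin
    c + (P + asc m (p ∷ acc))
      ≡⟨ lemma₁ c P (asc m (p ∷ acc)) ⟩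
    P + (c + asc m (p ∷ acc))
      ≡⟨ cong (λ x → P + (x + asc m (p ∷ acc))) (cong₂ carry (remainder-unique a q a<m) (remainder-unique b q′ b<m)) ⟨
    P + asc m (x ∷ p ∷ acc)
      ≡⟨ asc-rows q′ b zs (p ∷ acc) b<m bs<m ⟩
    sum (map proj₁ zs) + (d + (c + q)) + A
      ≡⟨ lemma₂ (sum (map proj₁ zs)) d c q A ⟩
    c + (d + sum (map proj₁ zs) + q + A) ∎)
    where
    open ≡-Reasoning
    c = carry a b
    p = a + q * m
    q′ = d + (c + q)
    x = b + q′ * m
    P = part (rows q′ b zs ʳ++ x ∷ p ∷ acc) 1 / m
    A = asc m (rows q′ b zs ʳ++ x ∷ p ∷ acc)
    lemma₁ : ∀ c p a → c + (p + a) ≡ p + (c + a)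
    lemma₁ = solve-∀
    lemma₂ : ∀ s d c q a → s + (d + (c + q)) + a ≡ c + (d + s + q + a)
    lemma₂ = solve-∀

  asc-reverse-rows : ∀ zs → Bounded (map proj₂ zs) →
    part (reverse (rows 0 0 zs)) 1 / m ≡ sum (map proj₁ zs) + asc m (reverse (rows 0 0 zs))
  asc-reverse-rows [] [] = 0/n≡0 m
  asc-reverse-rows ((d , b) ∷ zs) (b<m ∷ bs<m) =
    -- The first row has no carry, since `carry 0 b` computes to 0; hence the starting quotient
    -- `d + 0`.
    trans (sym (+-identityʳ _)) (trans (asc-rows (d + 0) b zs [] b<m bs<m)
      (cong (_+ asc m (reverse (rows 0 0 ((d , b) ∷ zs)))) (lemma (sum (map proj₁ zs)) d)))
    where
    lemma : ∀ s d → s + (d + 0) ≡ d + s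
    lemma = solve-∀

  countᵇ-rows : ∀ (c : ℕ) q a zs → Bounded (map proj₂ zs) →
    countᵇ (λ x → (x % m) ≡ᵇ c) (rows q a zs) ≡ countᵇ (_≡ᵇ c) (map proj₂ zs)
  countᵇ-rows c q a [] [] = refl
  countᵇ-rows c q a ((d , b) ∷ zs) (b<m ∷ bs<m) = begin
    countᵇ P (x ∷ xs)                  ≡⟨ countᵇ-∷ P x xs ⟩
    bit (x % m ≡ᵇ c) + countᵇ P xs     ≡⟨ cong₂ (λ r n → bit (r ≡ᵇ c) + n)
                                            (remainder-unique b q′ b<m) (countᵇ-rows c q′ b zs bs<m) ⟩
    bit (b ≡ᵇ c) + countᵇ (_≡ᵇ c) (map proj₂ zs)
                                       ≡⟨ countᵇ-∷ (_≡ᵇ c) b (map proj₂ zs) ⟨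
    countᵇ (_≡ᵇ c) (b ∷ map proj₂ zs)  ∎
    where
    open ≡-Reasoning
    P : ℕ → Bool
    P x = (x % m) ≡ᵇ c
    q′ = d + (carry a b + q)
    x = b + q′ * m
    xs = rows q′ b zs

-- Counting and Boolean tests

countᵇ-++ : ∀ {A : Set} (p : A → Bool) xs ys → countᵇ p (xs ++ ys) ≡ countᵇ p xs + countᵇ p ys
countᵇ-++ p xs ys = trans (cong length (filter-++ (T? ∘ p) xs ys)) (length-++ (filterᵇ p xs))

T⇒≡true : ∀ {b} → T b → b ≡ true
T⇒≡true {true} _ = refl

¬T⇒≡false : ∀ {b} → ¬ T b → b ≡ false
¬T⇒≡false {true} ¬t = ⊥-elim (¬t tt)
¬T⇒≡false {false} _ = refl

T-ext : ∀ {b c} → (T b → T c) → (T c → T b) → b ≡ c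
T-ext {true} f g = sym (T⇒≡true (f tt))
T-ext {false} {true} f g = ⊥-elim (g tt)
T-ext {false} {false} f g = refl

T-foldr-∧⁺ : ∀ {A : Set} (p : A → Bool) xs → All (T ∘ p) xs → T (foldr (λ x b → p x ∧ b) true xs)
T-foldr-∧⁺ p [] [] = tt
T-foldr-∧⁺ p (x ∷ xs) (px ∷ pxs) = Equivalence.from T-∧ (px , T-foldr-∧⁺ p xs pxs)

T-foldr-∧⁻ : ∀ {A : Set} (p : A → Bool) xs → T (foldr (λ x b → p x ∧ b) true xs) → All (T ∘ p) xs
T-foldr-∧⁻ p [] _ = []
T-foldr-∧⁻ p (x ∷ xs) t with Equivalence.to T-∧ t
... | px , t′ = px ∷ T-foldr-∧⁻ p xs t′

-- Multiplicities and conjugation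

mult : ℕ → List ℕ → ℕ
mult x = countᵇ (_≡ᵇ x)

mult-replicate : ∀ c x → mult x (replicate c x) ≡ c
mult-replicate zero x = refl
mult-replicate (suc c) x = trans (countᵇ-∷ (_≡ᵇ x) x (replicate c x))
  (cong₂ (λ b n → bit b + n) (T⇒≡true (≡⇒≡ᵇ x x refl)) (mult-replicate c x))

mult-replicate-≢ : ∀ c {x y} → y ≢ x → mult x (replicate c y) ≡ 0
mult-replicate-≢ zero y≢x = refl
mult-replicate-≢ (suc c) {x} {y} y≢x = trans (countᵇ-∷ (_≡ᵇ x) y (replicate c y))
  (cong₂ (λ b n → bit b + n) (¬T⇒≡false (y≢x ∘ ≡ᵇ⇒≡ y x)) (mult-replicate-≢ c y≢x))

mult-partition : ∀ {k x μ} → Partition k μ → k < x → mult x μ ≡ 0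
mult-partition [] k<x = refl
mult-partition {x = x} (cons {j} {js = js} 1≤j j≤k p) k<x = trans (countᵇ-∷ (_≡ᵇ x) j js)
  (cong₂ (λ b n → bit b + n) (¬T⇒≡false (<⇒≢ (≤-<-trans j≤k k<x) ∘ ≡ᵇ⇒≡ j x))
         (mult-partition p (≤-<-trans j≤k k<x)))

mult-∉ : ∀ {x μ} → All (_≢ x) μ → mult x μ ≡ 0
mult-∉ [] = refl
mult-∉ {x} {y ∷ μ} (y≢x ∷ ys) = trans (countᵇ-∷ (_≡ᵇ x) y μ)
  (cong₂ (λ b n → bit b + n) (¬T⇒≡false (y≢x ∘ ≡ᵇ⇒≡ y x)) (mult-∉ ys))

-- The conjugate of the partition with parts ys (smallest first), where p is subtracted from each part.
blocks : ℕ → List ℕ → List ℕ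
blocks p [] = []
blocks p (y ∷ ys) = replicate (y ∸ p) (suc (length ys)) ++ blocks y ys

Partition-weaken : ∀ {k k′ μ} → k ≤ k′ → Partition k μ → Partition k′ μ
Partition-weaken k≤ [] = []
Partition-weaken k≤ (cons 1≤j j≤k p) = cons 1≤j (≤-trans j≤k k≤) p

replicate-partition : ∀ c {L μ} → Partition (suc L) μ → Partition (suc L) (replicate c (suc L) ++ μ)
replicate-partition zero p = p
replicate-partition (suc c) p = cons (s≤s z≤n) ≤-refl (replicate-partition c p)

blocks-partition : ∀ p ys → Partition (length ys) (blocks p ys)
blocks-partition p [] = []
blocks-partition p (y ∷ ys) =
  replicate-partition (y ∸ p) (Partition-weaken (n≤1+n _) (blocks-partition y ys))

sum-replicate : ∀ c x → sum (replicate c x) ≡ c * x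
sum-replicate zero x = refl
sum-replicate (suc c) x = cong (x +_) (sum-replicate c x)

sum-blocks : ∀ {p ys} → Increasing p ys → sum (blocks p ys) + p * length ys ≡ sum ys
sum-blocks {p} [] = *-zeroʳ p
sum-blocks {p} {y ∷ ys} (cons p≤y inc) = begin
  sum (replicate c (suc n) ++ blocks y ys) + p * suc n
    ≡⟨ cong (_+ p * suc n) (trans (sum-++ (replicate c (suc n)) _) (cong (_+ S) (sum-replicate c (suc n)))) ⟩
  c * suc n + S + p * suc n
    ≡⟨ lemma p c n S ⟩
  (p + c) + (S + (p + c) * n)
    ≡⟨ cong (λ z → z + (S + z * n)) (m+[n∸m]≡n p≤y) ⟩
  y + (S + y * n)
    ≡⟨ cong (y +_) (sum-blocks inc) ⟩
  y + sum ys ∎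
  where
  open ≡-Reasoning
  c = y ∸ p
  n = length ys
  S = sum (blocks y ys)
  lemma : ∀ p c n s → c * suc n + s + p * suc n ≡ (p + c) + (s + (p + c) * n)
  lemma = solve-∀

part-replicate-< : ∀ {c t} L μ → t < c → part (replicate c L ++ μ) (suc t) ≡ L
part-replicate-< {suc c} {zero} L μ _ = refl
part-replicate-< {suc c} {suc t} L μ (s≤s t<c) = part-replicate-< L μ t<c

part-replicate-+ : ∀ c t L μ → part (replicate c L ++ μ) (suc (c + t)) ≡ part μ (suc t)
part-replicate-+ zero t L μ = refl
part-replicate-+ (suc c) t L μ = part-replicate-+ c t L μ

countᵇ-≤-Increasing : ∀ {r p ys} → r ≤ p → Increasing p ys → countᵇ (r ≤ᵇ_) ys ≡ length ys
countᵇ-≤-Increasing r≤p [] = refl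
countᵇ-≤-Increasing {r} {ys = y ∷ ys} r≤p (cons p≤y inc) = trans (countᵇ-∷ (r ≤ᵇ_) y ys)
  (cong₂ (λ b n → bit b + n) (T⇒≡true (≤⇒≤ᵇ (≤-trans r≤p p≤y)))
         (countᵇ-≤-Increasing (≤-trans r≤p p≤y) inc))

-- The usual formula for the parts of a conjugate. Either the index falls into the first block,
-- whose parts count all of `y ∷ ys`, or that block is skipped and `p` moves up to `y`.
part-blocks : ∀ {p ys} t → Increasing p ys → part (blocks p ys) (suc t) ≡ countᵇ (p + suc t ≤ᵇ_) ys
part-blocks t [] = refl
part-blocks {p} {y ∷ ys} t inc@(cons p≤y inc′) with t <? y ∸ p
... | yes t<c = trans (part-replicate-< _ _ t<c)
  (trans (sym (cong suc (countᵇ-≤-Increasing le inc′)))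
    (sym (trans (countᵇ-∷ (p + suc t ≤ᵇ_) y ys) (cong (λ b → bit b + _) (T⇒≡true (≤⇒≤ᵇ le))))))
  where
  le : p + suc t ≤ y
  le = ≤-trans (+-monoʳ-≤ p t<c) (≤-reflexive (m+[n∸m]≡n p≤y))
... | no t≮c = begin
  part (replicate c (suc (length ys)) ++ blocks y ys) (suc t)
    ≡⟨ cong (λ s → part (replicate c (suc (length ys)) ++ blocks y ys) (suc s)) (m+[n∸m]≡n c≤t) ⟨
  part (replicate c (suc (length ys)) ++ blocks y ys) (suc (c + t′))
    ≡⟨ part-replicate-+ c t′ _ _ ⟩
  part (blocks y ys) (suc t′)
    ≡⟨ part-blocks t′ inc′ ⟩
  countᵇ (y + suc t′ ≤ᵇ_) ys
    ≡⟨ cong (λ r → countᵇ (r ≤ᵇ_) ys) shift ⟩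
  countᵇ (p + suc t ≤ᵇ_) ys
    ≡⟨ cong (λ b → bit b + _) (¬T⇒≡false {p + suc t ≤ᵇ y} (λ le → <⇒≱ y<r (≤ᵇ⇒≤ _ _ le))) ⟨
  bit (p + suc t ≤ᵇ y) + countᵇ (p + suc t ≤ᵇ_) ys
    ≡⟨ countᵇ-∷ (p + suc t ≤ᵇ_) y ys ⟨
  countᵇ (p + suc t ≤ᵇ_) (y ∷ ys) ∎
  where
  open ≡-Reasoning
  c = y ∸ p
  c≤t = ≮⇒≥ t≮c
  t′ = t ∸ c
  shift : y + suc t′ ≡ p + suc t
  shift = trans (cong (_+ suc t′) (sym (m+[n∸m]≡n p≤y)))
    (trans (+-assoc p c (suc t′)) (cong (p +_) (trans (+-suc c t′) (cong suc (m+[n∸m]≡n c≤t)))))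
  y<r : y < p + suc t
  y<r = subst (y <_) shift (m<m+n y (s≤s z≤n))

bit-≤ᵇ-split : ∀ t y → bit (t ≤ᵇ y) ≡ bit (t ≡ᵇ y) + bit (suc t ≤ᵇ y)
bit-≤ᵇ-split zero zero = refl
bit-≤ᵇ-split zero (suc y) = refl
bit-≤ᵇ-split (suc t) zero = refl
bit-≤ᵇ-split (suc zero) (suc y) = bit-≤ᵇ-split zero y
bit-≤ᵇ-split (suc (suc t)) (suc y) = bit-≤ᵇ-split (suc t) y

countᵇ-≤ᵇ-split : ∀ t ys → countᵇ (t ≤ᵇ_) ys ≡ countᵇ (t ≡ᵇ_) ys + countᵇ (suc t ≤ᵇ_) ys
countᵇ-≤ᵇ-split t [] = refl
countᵇ-≤ᵇ-split t (y ∷ ys)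
  rewrite countᵇ-∷ (t ≤ᵇ_) y ys | countᵇ-∷ (t ≡ᵇ_) y ys | countᵇ-∷ (suc t ≤ᵇ_) y ys
        | bit-≤ᵇ-split t y | countᵇ-≤ᵇ-split t ys =
  lemma (bit (t ≡ᵇ y)) (bit (suc t ≤ᵇ y)) (countᵇ (t ≡ᵇ_) ys) (countᵇ (suc t ≤ᵇ_) ys)
  where
  lemma : ∀ a b c d → a + b + (c + d) ≡ a + c + (b + d)
  lemma = solve-∀

part-difference-blocks : ∀ {ys} t → Increasing 0 ys →
  part (blocks 0 ys) (suc t) ∸ part (blocks 0 ys) (suc (suc t)) ≡ countᵇ (suc t ≡ᵇ_) ys
part-difference-blocks {ys} t inc = begin
  part (blocks 0 ys) (suc t) ∸ part (blocks 0 ys) (suc (suc t))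
    ≡⟨ cong₂ _∸_ (part-blocks t inc) (part-blocks (suc t) inc) ⟩
  countᵇ (suc t ≤ᵇ_) ys ∸ countᵇ (suc (suc t) ≤ᵇ_) ys
    ≡⟨ cong (_∸ countᵇ (suc (suc t) ≤ᵇ_) ys) (countᵇ-≤ᵇ-split (suc t) ys) ⟩
  countᵇ (suc t ≡ᵇ_) ys + countᵇ (suc (suc t) ≤ᵇ_) ys ∸ countᵇ (suc (suc t) ≤ᵇ_) ys
    ≡⟨ m+n∸n≡m _ (countᵇ (suc (suc t) ≤ᵇ_) ys) ⟩
  countᵇ (suc t ≡ᵇ_) ys ∎
  where open ≡-Reasoning

-- The summation range in `sᵢ` is given by the number of parts of the conjugate; this bound shows
-- that the range reaches every entry of `ys`.
≤-length-blocks : ∀ {p ys} → Increasing p ys → All (_≤ p + length (blocks p ys)) ys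
≤-length-blocks [] = []
≤-length-blocks {p} {y ∷ ys} (cons p≤y inc) = subst (λ z → All (_≤ z) (y ∷ ys)) (sym eq)
  (m≤m+n y _ ∷ ≤-length-blocks inc)
  where
  eq : p + length (replicate (y ∸ p) (suc (length ys)) ++ blocks y ys) ≡ y + length (blocks y ys)
  eq = trans (cong (p +_) (trans (length-++ (replicate (y ∸ p) (suc (length ys))))
               (cong (_+ length (blocks y ys)) (length-replicate (y ∸ p)))))
         (trans (sym (+-assoc p (y ∸ p) _)) (cong (_+ length (blocks y ys)) (m+[n∸m]≡n p≤y)))

mult-largest-blocks : ∀ p y ys → mult (suc (length ys)) (blocks p (y ∷ ys)) ≡ y ∸ p
mult-largest-blocks p y ys =
  trans (countᵇ-++ (_≡ᵇ suc (length ys)) (replicate (y ∸ p) (suc (length ys))) (blocks y ys))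
    (trans (cong₂ _+_ (mult-replicate (y ∸ p) (suc (length ys))) (mult-partition (blocks-partition y ys) ≤-refl))
           (+-identityʳ _))

-- The first difference is the multiplicity of the largest possible part `suc (length ys)`. Equal
-- lengths have to be assumed because an entry equal to `p` at the front gives an empty block.
blocks-injective : ∀ {p ys ys′} → Increasing p ys → Increasing p ys′ → length ys ≡ length ys′ →
  blocks p ys ≡ blocks p ys′ → ys ≡ ys′
blocks-injective [] [] _ _ = refl
blocks-injective {p} {y ∷ ys} {y′ ∷ ys′} (cons p≤y inc) (cons p≤y′ inc′) len eq
  with suc-injective len
... | len′ with ∸-cancelʳ-≡ p≤y p≤y′ multiplicities
  where
  multiplicities : y ∸ p ≡ y′ ∸ p
  multiplicities = trans (sym (mult-largest-blocks p y ys))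
    (trans (cong₂ (λ l → mult (suc l)) len′ eq) (mult-largest-blocks p y′ ys′))
... | refl = cong (y ∷_) (blocks-injective inc inc′ len′
  (++-cancelˡ (replicate (y ∸ p) (suc (length ys))) _ _
    (trans eq (cong (λ l → replicate (y ∸ p) (suc l) ++ blocks y ys′) (sym len′)))))

splitLargest : ∀ {L μ} → Partition (suc L) μ →
  ∃₂ λ c μ′ → μ ≡ replicate c (suc L) ++ μ′ × Partition L μ′
splitLargest [] = 0 , [] , refl , []
splitLargest {L} (cons {j} {js = js} 1≤j j≤1+L p) with m≤n⇒m<n∨m≡n j≤1+L
... | inj₁ (s≤s j≤L) = 0 , j ∷ js , refl , cons 1≤j j≤L p
... | inj₂ refl with splitLargest p
... | c , μ′ , refl , p′ = suc c , μ′ , refl , p′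

-- Sums over the indices `km + i`, and conjugation of `D_m`

sum-map-+ : ∀ {A : Set} (f g : A → ℕ) xs → sum (map (λ x → f x + g x) xs) ≡ sum (map f xs) + sum (map g xs)
sum-map-+ f g [] = refl
sum-map-+ f g (x ∷ xs) = trans (cong (f x + g x +_) (sum-map-+ f g xs))
  (lemma (f x) (g x) (sum (map f xs)) (sum (map g xs)))
  where
  lemma : ∀ a b c d → a + b + (c + d) ≡ a + c + (b + d)
  lemma = solve-∀

sum-map-zero : ∀ {A : Set} (xs : List A) → sum (map (λ _ → 0) xs) ≡ 0
sum-map-zero [] = refl
sum-map-zero (x ∷ xs) = sum-map-zero xs

sum-map-upTo-suc : ∀ (f : ℕ → ℕ) n → sum (map f (upTo (suc n))) ≡ f 0 + sum (map (f ∘ suc) (upTo n))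
sum-map-upTo-suc f n = cong (λ l → f 0 + sum l) (trans (map-applyUpTo suc f n) (sym (map-applyUpTo id (f ∘ suc) n)))

sum-bit-≡ᵇ : ∀ c {q n} → q < n → sum (map (λ k → bit ((k ≡ᵇ q) ∧ c)) (upTo n)) ≡ bit c
sum-bit-≡ᵇ c {zero} {suc n} _ =
  trans (sum-map-upTo-suc (λ k → bit ((k ≡ᵇ 0) ∧ c)) n)
        (trans (cong (bit c +_) (sum-map-zero (upTo n))) (+-identityʳ _))
sum-bit-≡ᵇ c {suc q} {suc n} (s≤s q<n) =
  trans (sum-map-upTo-suc (λ k → bit ((k ≡ᵇ suc q) ∧ c)) n) (sum-bit-≡ᵇ c q<n)

-- Double counting: the sums over `xs` and over `ys` are exchanged.
sum-map-countᵇ : ∀ {A B : Set} (P : A → B → Bool) (Q : B → Bool) xs ys →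
  All (λ y → sum (map (λ x → bit (P x y)) xs) ≡ bit (Q y)) ys →
  sum (map (λ x → countᵇ (P x) ys) xs) ≡ countᵇ Q ys
sum-map-countᵇ P Q xs [] [] = sum-map-zero xs
sum-map-countᵇ P Q xs (y ∷ ys) (eq ∷ eqs) = begin
  sum (map (λ x → countᵇ (P x) (y ∷ ys)) xs)
    ≡⟨ cong sum (map-cong (λ x → countᵇ-∷ (P x) y ys) xs) ⟩
  sum (map (λ x → bit (P x y) + countᵇ (P x) ys) xs)
    ≡⟨ sum-map-+ (λ x → bit (P x y)) (λ x → countᵇ (P x) ys) xs ⟩
  sum (map (λ x → bit (P x y)) xs) + sum (map (λ x → countᵇ (P x) ys) xs)
    ≡⟨ cong₂ _+_ eq (sum-map-countᵇ P Q xs ys eqs) ⟩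
  bit (Q y) + countᵇ Q ys
    ≡⟨ countᵇ-∷ Q y ys ⟨
  countᵇ Q (y ∷ ys) ∎
  where open ≡-Reasoning

Increasing⇒All-≤ : ∀ {p ys} → Increasing p ys → All (p ≤_) ys
Increasing⇒All-≤ [] = []
Increasing⇒All-≤ (cons p≤y inc) = p≤y ∷ All.map (≤-trans p≤y) (Increasing⇒All-≤ inc)

Increasing-weaken : ∀ {p q ys} → q ≤ p → Increasing p ys → Increasing q ys
Increasing-weaken q≤p [] = []
Increasing-weaken q≤p (cons p≤y inc) = cons (≤-trans q≤p p≤y) inc

module _ (m : ℕ) .{{_ : NonZero m}} where

  suc-%-injective : ∀ {i b} → i < m → b < m → suc i % m ≡ suc b % m → i ≡ b
  suc-%-injective i<m b<m eq with m≤n⇒m<n∨m≡n i<m | m≤n⇒m<n∨m≡n b<m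
  ... | inj₁ i<  | inj₁ b<  = suc-injective (trans (sym (m<n⇒m%n≡m i<)) (trans eq (m<n⇒m%n≡m b<)))
  ... | inj₁ i<  | inj₂ refl with () ← trans (sym (m<n⇒m%n≡m i<)) (trans eq (n%n≡0 m))
  ... | inj₂ refl | inj₁ b<  with () ← trans (sym (n%n≡0 m)) (trans eq (m<n⇒m%n≡m b<))
  ... | inj₂ refl | inj₂ eq′ = suc-injective (sym eq′)

  -- Dividing the predecessor of the positive number gives remainders 0 to m - 1, which match the
  -- index `suc i` running from 1 to m. Only the quotient `q` can contribute as `k`, and it lies
  -- below `n`.
  sum-bit-residue : ∀ {i y n} → i < m → 0 < y → y < n →
    sum (map (λ k → bit (k * m + suc i ≡ᵇ y)) (upTo n)) ≡ bit (y % m ≡ᵇ suc i % m)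
  sum-bit-residue {i} {suc y} {n} i<m _ y<n with divide m y
  ... | b , q , b<m , refl = begin
    sum (map (λ k → bit (k * m + suc i ≡ᵇ suc (b + q * m))) (upTo n))
      ≡⟨ cong sum (map-cong (λ k → cong bit (step₁ k)) (upTo n)) ⟩
    sum (map (λ k → bit ((k ≡ᵇ q) ∧ (i ≡ᵇ b))) (upTo n))
      ≡⟨ sum-bit-≡ᵇ (i ≡ᵇ b) (≤-<-trans (≤-trans (m≤m*n q m) (m≤n+m _ (suc b))) y<n) ⟩
    bit (i ≡ᵇ b)
      ≡⟨ cong bit step₂ ⟩
    bit (suc (b + q * m) % m ≡ᵇ suc i % m) ∎
    where
    open ≡-Reasoning
    swap : ∀ k → k * m + suc i ≡ suc (i + k * m)
    swap k = trans (+-suc (k * m) i) (cong suc (+-comm (k * m) i))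
    step₁ : ∀ k → (k * m + suc i ≡ᵇ suc (b + q * m)) ≡ (k ≡ᵇ q) ∧ (i ≡ᵇ b)
    step₁ k rewrite swap k = T-ext to from
      where
      to : T (i + k * m ≡ᵇ b + q * m) → T ((k ≡ᵇ q) ∧ (i ≡ᵇ b))
      to t with divide-unique m i<m b<m (≡ᵇ⇒≡ (i + k * m) (b + q * m) t)
      ... | i≡b , k≡q = Equivalence.from T-∧ (≡⇒≡ᵇ k q k≡q , ≡⇒≡ᵇ i b i≡b)
      from : T ((k ≡ᵇ q) ∧ (i ≡ᵇ b)) → T (i + k * m ≡ᵇ b + q * m)
      from t with Equivalence.to (T-∧ {k ≡ᵇ q}) t
      ... | tk , ti = ≡⇒≡ᵇ (i + k * m) (b + q * m)
        (cong₂ (λ a c → a + c * m) (≡ᵇ⇒≡ i b ti) (≡ᵇ⇒≡ k q tk))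
    step₂ : (i ≡ᵇ b) ≡ (suc (b + q * m) % m ≡ᵇ suc i % m)
    step₂ = T-ext
      (λ t → ≡⇒≡ᵇ (suc (b + q * m) % m) (suc i % m)
         (trans ([m+kn]%n≡m%n (suc b) q m) (cong (λ x → suc x % m) (sym (≡ᵇ⇒≡ i b t)))))
      (λ t → ≡⇒≡ᵇ i b (suc-%-injective i<m b<m
         (sym (trans (sym ([m+kn]%n≡m%n (suc b) q m)) (≡ᵇ⇒≡ (suc (b + q * m) % m) (suc i % m) t)))))

  -- The term of `s_i` with index `k` counts the entries of `ys` equal to `km + i`. The entries must
  -- be positive, since an entry 0 would be counted on the right for `i = m` but not on the left.
  sᵢ-blocks : ∀ {i ys} → i < m → Increasing 1 ys →
    sᵢ m (suc i) (blocks 0 ys) ≡ countᵇ (λ y → (y % m) ≡ᵇ (suc i % m)) ys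
  sᵢ-blocks {i} {ys} i<m inc = trans (cong sum (map-cong difference ks))
    (sum-map-countᵇ (λ k → k * m + suc i ≡ᵇ_) (λ y → (y % m) ≡ᵇ (suc i % m)) ks ys
      (All.zipWith (λ (0<y , y≤) → sum-bit-residue i<m 0<y (s≤s y≤))
        (Increasing⇒All-≤ inc , ≤-length-blocks inc₀)))
    where
    inc₀ = Increasing-weaken z≤n inc
    ks = upTo (suc (length (blocks 0 ys)))
    difference : ∀ k → part (blocks 0 ys) (k * m + suc i) ∸ part (blocks 0 ys) (k * m + suc i + 1)
                     ≡ countᵇ (k * m + suc i ≡ᵇ_) ys
    difference k rewrite +-suc (k * m) i | +-comm (k * m + i) 1 = part-difference-blocks (k * m + i) inc₀

  inD⁺ : ∀ {μ} → (∀ x → mult x μ < m) → T (inD m μ)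
  inD⁺ {μ} mult<m = T-foldr-∧⁺ (λ x → mult x μ ≤ᵇ m ∸ 1) μ
    (All.universal (λ x → ≤⇒≤ᵇ (<⇒≤pred (mult<m x))) μ)

  inD⁻ : ∀ {μ} → T (inD m μ) → ∀ x → mult x μ < m
  inD⁻ {μ} t x with x ∈? μ
  ... | yes x∈μ = subst (mult x μ <_) (suc-pred m)
    (s≤s (≤ᵇ⇒≤ _ _ (All.lookup (T-foldr-∧⁻ (λ x → mult x μ ≤ᵇ m ∸ 1) μ t) x∈μ)))
  ... | no x∉μ = subst (_< m) (sym (mult-∉ (All.map ≢-sym (All.¬Any⇒All¬ μ x∉μ)))) (>-nonZero⁻¹ m)

  -- Different blocks consist of different parts, so every multiplicity is 0 or one of the
  -- differences `y ∸ p`.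
  mult-blocks : ∀ {p ys} → Flat m p ys → ∀ x → mult x (blocks p ys) < m
  mult-blocks [] x = >-nonZero⁻¹ m
  mult-blocks {p} {y ∷ ys} (cons p≤y y<p+m fl) x
    rewrite countᵇ-++ (_≡ᵇ x) (replicate (y ∸ p) (suc (length ys))) (blocks y ys)
    with suc (length ys) ≟ x
  ... | yes refl rewrite mult-replicate (y ∸ p) (suc (length ys))
      | mult-partition (blocks-partition y ys) ≤-refl | +-identityʳ (y ∸ p) =
    +-cancelˡ-< p (y ∸ p) m (subst (_< p + m) (sym (m+[n∸m]≡n p≤y)) y<p+m)
  ... | no L≢x rewrite mult-replicate-≢ (y ∸ p) L≢x = mult-blocks fl x

  -- The multiplicity `c` of the largest possible part `L`, possibly 0, becomes the first
  -- difference; the remaining parts are treated with `p + c` in place of `p`.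
  blocks-surjective : ∀ L p {μ} → Partition L μ → (∀ x → mult x μ < m) →
    ∃ λ ys → length ys ≡ L × Flat m p ys × blocks p ys ≡ μ
  blocks-surjective zero p [] _ = [] , refl , [] , refl
  blocks-surjective zero p (cons 1≤j j≤0 _) _ = ⊥-elim (<⇒≱ 1≤j j≤0)
  blocks-surjective (suc L) p ptn mult<m with splitLargest ptn
  ... | c , μ′ , refl , ptn′
    with blocks-surjective L (p + c) ptn′ (λ x → ≤-<-trans
           (≤-trans (m≤n+m _ (mult x (replicate c (suc L))))
             (≤-reflexive (sym (countᵇ-++ (_≡ᵇ x) (replicate c (suc L)) μ′)))) (mult<m x))
  ... | ys , refl , fl , refl =
    p + c ∷ ys , refl , cons (m≤m+n p c) (+-monoʳ-< p c<m) fl ,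
    cong (λ k → replicate k (suc L) ++ blocks (p + c) ys) (m+n∸m≡n p c)
    where
    c<m : c < m
    c<m = subst (_< m) (trans (countᵇ-++ (_≡ᵇ suc L) (replicate c (suc L)) (blocks (p + c) ys))
        (trans (cong₂ _+_ (mult-replicate c (suc L)) (mult-partition ptn′ ≤-refl)) (+-identityʳ c)))
      (mult<m (suc L))

-- Assembling and decomposing words

map-proj₁-zipPairs : ∀ {n} (xs ys : Vec ℕ n) → map proj₁ (zipPairs xs ys) ≡ toList xs
map-proj₁-zipPairs [] [] = refl
map-proj₁-zipPairs (x ∷ xs) (_ ∷ ys) = cong (x ∷_) (map-proj₁-zipPairs xs ys)

map-proj₂-zipPairs : ∀ {n} (xs ys : Vec ℕ n) → map proj₂ (zipPairs xs ys) ≡ toList ys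
map-proj₂-zipPairs [] [] = refl
map-proj₂-zipPairs (_ ∷ xs) (y ∷ ys) = cong (y ∷_) (map-proj₂-zipPairs xs ys)

zipPairs-injective : ∀ {n} (xs ys xs′ ys′ : Vec ℕ n) → zipPairs xs ys ≡ zipPairs xs′ ys′ → xs ≡ xs′ × ys ≡ ys′
zipPairs-injective [] [] [] [] _ = refl , refl
zipPairs-injective (x ∷ xs) (y ∷ ys) (_ ∷ xs′) (_ ∷ ys′) eq with ∷-injective eq
... | refl , eq′ with zipPairs-injective xs ys xs′ ys′ eq′
... | refl , refl = refl , refl

zipPairs-injective-length : ∀ {n n′} (xs ys : Vec ℕ n) (xs′ ys′ : Vec ℕ n′) →
  zipPairs xs ys ≡ zipPairs xs′ ys′ → n ≡ n′
zipPairs-injective-length xs ys xs′ ys′ eq =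
  trans (sym (length-zipPairs xs ys)) (trans (cong length eq) (length-zipPairs xs′ ys′))

zipPairs-surjective : ∀ zs → ∃ λ n → ∃₂ λ (xs ys : Vec ℕ n) → zipPairs xs ys ≡ zs
zipPairs-surjective [] = 0 , [] , [] , refl
zipPairs-surjective ((x , y) ∷ zs) with zipPairs-surjective zs
... | n , xs , ys , refl = suc n , x ∷ xs , y ∷ ys , refl

sum-toList : ∀ {n} (xs : Vec ℕ n) → sum (toList xs) ≡ Vec.sum xs
sum-toList [] = refl
sum-toList (x ∷ xs) = cong (x +_) (sum-toList xs)

map-proj₂-flat : ∀ w → map proj₂ (flat w) ≡ w
map-proj₂-flat [] = refl
map-proj₂-flat (b ∷ w) = cong (b ∷_) (map-proj₂-flat w)

All-ʳ++ : ∀ {A : Set} {P : A → Set} {xs ys} → All P xs → All P ys → All P (xs ʳ++ ys)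
All-ʳ++ [] pys = pys
All-ʳ++ (px ∷ pxs) pys = All-ʳ++ pxs (px ∷ pys)

ʳ++-partition : ∀ {p xs acc} → 1 ≤ p → Increasing p xs → Partition p acc → ∃ λ k → Partition k (xs ʳ++ acc)
ʳ++-partition {p} _ [] ptn = p , ptn
ʳ++-partition 1≤p (cons p≤x inc) ptn =
  ʳ++-partition (≤-trans 1≤p p≤x) inc (cons (≤-trans 1≤p p≤x) ≤-refl (Partition-weaken p≤x ptn))

ʳ++-increasing : ∀ {k la acc} → Partition k la → Increasing k acc → Increasing 0 (la ʳ++ acc)
ʳ++-increasing [] inc = Increasing-weaken z≤n inc
ʳ++-increasing (cons _ j≤k ptn) inc = ʳ++-increasing ptn (cons ≤-refl (Increasing-weaken j≤k inc))

sum-zeros-++ : ∀ k w → sum (replicate k 0 ++ w) ≡ sum w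
sum-zeros-++ zero w = refl
sum-zeros-++ (suc k) w = sum-zeros-++ k w

sum-expand : ∀ zs → sum (expand zs) ≡ sum (map proj₂ zs)
sum-expand [] = refl
sum-expand ((k , b) ∷ zs) = cong (b +_) (trans (sum-zeros-++ k (expand zs)) (sum-expand zs))

mult-expand-suc : ∀ c zs → mult (suc c) (expand zs) ≡ mult (suc c) (map proj₂ zs)
mult-expand-suc c [] = refl
mult-expand-suc c ((k , b) ∷ zs) = begin
  mult (suc c) (b ∷ replicate k 0 ++ expand zs)
    ≡⟨ countᵇ-∷ (_≡ᵇ suc c) b _ ⟩
  bit (b ≡ᵇ suc c) + mult (suc c) (replicate k 0 ++ expand zs)
    ≡⟨ cong (bit (b ≡ᵇ suc c) +_) (countᵇ-++ (_≡ᵇ suc c) (replicate k 0) (expand zs)) ⟩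
  bit (b ≡ᵇ suc c) + (mult (suc c) (replicate k 0) + mult (suc c) (expand zs))
    ≡⟨ cong₂ (λ x y → bit (b ≡ᵇ suc c) + (x + y)) (mult-replicate-≢ k (λ ())) (mult-expand-suc c zs) ⟩
  bit (b ≡ᵇ suc c) + mult (suc c) (map proj₂ zs)
    ≡⟨ countᵇ-∷ (_≡ᵇ suc c) b _ ⟨
  mult (suc c) (b ∷ map proj₂ zs) ∎
  where open ≡-Reasoning

mult-expand-zero : ∀ zs → All (0 <_) (map proj₂ zs) → mult 0 (expand zs) ≡ sum (map proj₁ zs)
mult-expand-zero [] [] = refl
mult-expand-zero ((k , suc b) ∷ zs) (_ ∷ bs>0) =
  trans (countᵇ-++ (_≡ᵇ 0) (replicate k 0) (expand zs))
        (cong₂ _+_ (mult-replicate k 0) (mult-expand-zero zs bs>0))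

-- The leading block of zeros is the generalisation needed for the induction: it is what remains in
-- front once the first letter of an expansion is removed. Positive letters mark where a block ends.
expand-injective-++ : ∀ k k′ zs zs′ → All (0 <_) (map proj₂ zs) → All (0 <_) (map proj₂ zs′) →
  replicate k 0 ++ expand zs ≡ replicate k′ 0 ++ expand zs′ → k ≡ k′ × zs ≡ zs′
expand-injective-++ zero zero [] [] _ _ _ = refl , refl
expand-injective-++ zero zero ((k , b) ∷ zs) ((k′ , b′) ∷ zs′) (_ ∷ bs) (_ ∷ bs′) eq with ∷-injective eq
... | refl , eq′ with expand-injective-++ k k′ zs zs′ bs bs′ eq′
... | refl , refl = refl , refl
expand-injective-++ zero (suc k′) ((k , suc b) ∷ zs) zs′ _ _ ()
expand-injective-++ zero (suc k′) ((k , zero) ∷ zs) zs′ (() ∷ _) _ _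
expand-injective-++ (suc k) zero zs ((k′ , zero) ∷ zs′) _ (() ∷ _) _
expand-injective-++ (suc k) zero zs ((k′ , suc b) ∷ zs′) _ _ ()
expand-injective-++ (suc k) (suc k′) zs zs′ bs bs′ eq
  with expand-injective-++ k k′ zs zs′ bs bs′ (proj₂ (∷-injective eq))
... | refl , eq′ = refl , eq′

expand-surjective-++ : ∀ w → ∃₂ λ k zs → w ≡ replicate k 0 ++ expand zs × All (0 <_) (map proj₂ zs)
expand-surjective-++ [] = 0 , [] , refl , []
expand-surjective-++ (b ∷ w) with expand-surjective-++ w
expand-surjective-++ (zero ∷ w) | k , zs , refl , bs>0 = suc k , zs , refl , bs>0
expand-surjective-++ (suc b ∷ w) | k , zs , refl , bs>0 = 0 , (k , suc b) ∷ zs , refl , s≤s z≤n ∷ bs>0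

-- As words are read from right to left, the hypothesis on `take 1 w` says that the word does not
-- end in 0.
expand-surjective : ∀ w → All (0 <_) (take 1 w) → ∃ λ zs → w ≡ expand zs × All (0 <_) (map proj₂ zs)
expand-surjective w w₁>0 with expand-surjective-++ w
... | zero , zs , eq , bs>0 = zs , eq , bs>0
expand-surjective (zero ∷ _) (() ∷ _) | suc k , zs , refl , bs>0

All-expand⁺ : ∀ {P : ℕ → Set} zs → P 0 → All P (map proj₂ zs) → All P (expand zs)
All-expand⁺ [] p0 [] = []
All-expand⁺ ((k , b) ∷ zs) p0 (pb ∷ pbs) = pb ∷ All.++⁺ (All.replicate⁺ k p0) (All-expand⁺ zs p0 pbs)

All-expand⁻ : ∀ {P : ℕ → Set} zs → All P (expand zs) → All P (map proj₂ zs)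
All-expand⁻ [] [] = []
All-expand⁻ ((k , b) ∷ zs) (pb ∷ ps) = pb ∷ All-expand⁻ zs (All.++⁻ʳ (replicate k 0) ps)

take-1-expand : ∀ zs → All (0 <_) (map proj₂ zs) → All (0 <_) (take 1 (expand zs))
take-1-expand [] [] = []
take-1-expand ((k , b) ∷ zs) (b>0 ∷ _) = b>0 ∷ []

-- A positive smallest entry makes the first block nonempty. Hence the conjugate determines the
-- length that `blocks-injective` requires.
part-1-blocks : ∀ {ys} → Increasing 1 ys → part (blocks 0 ys) 1 ≡ length ys
part-1-blocks [] = refl
part-1-blocks (cons {x = suc y} _ _) = refl

-- The two encodings of words with inserted zeros

-- The components are the nonzero letters (last letter first) and the numbers of zeros before them.
Word : Set
Word = Σ ℕ λ n → Vec ℕ n × Vec ℕ n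

module _ (m : ℕ) .{{_ : NonZero m}} where

  0<m : 0 < m
  0<m = >-nonZero⁻¹ m

  IsWord : Word → Set
  IsWord (_ , bs , _) = All (0 <_) (toList bs) × Bounded m (toList bs)

  -- The conjugate of the partition in `D_m`, smallest part first: the zeros are letters, and every
  -- row is minimal.
  distinctRows : Word → List ℕ
  distinctRows (_ , bs , ks) = rows m 0 0 (flat (expand (zipPairs ks bs)))

  -- The partition in `O_m`, smallest part first: only the nonzero letters are residues, and the
  -- zeros have become the differences of π.
  regularRows : Word → List ℕ
  regularRows (_ , bs , ks) = rows m 0 0 (zipPairs (insertZeros bs ks) bs)

  toDistinct : Word → List ℕ
  toDistinct = blocks 0 ∘ distinctRows

  toRegular : Word → List ℕ
  toRegular = reverse ∘ regularRows

  bounded-flat : ∀ zs → Bounded m (map proj₂ zs) → Bounded m (map proj₂ (flat (expand zs)))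
  bounded-flat zs bs<m = subst (Bounded m) (sym (map-proj₂-flat (expand zs))) (All-expand⁺ zs 0<m bs<m)

  rows-increasing-1 : ∀ zs → Bounded m (map proj₂ zs) → All (0 <_) (take 1 (map proj₂ zs)) →
    Increasing 1 (rows m 0 0 zs)
  rows-increasing-1 [] _ _ = []
  rows-increasing-1 ((d , b) ∷ zs) (b<m ∷ bs<m) (b>0 ∷ _) =
    cons (≤-trans b>0 (m≤m+n b _)) (rows-increasing m _ b zs b<m bs<m)

  rows-residue⁺ : ∀ q a zs → Bounded m (map proj₂ zs) → All (0 <_) (map proj₂ zs) →
    All (λ x → T (not ((x % m) ≡ᵇ 0))) (rows m q a zs)
  rows-residue⁺ q a [] [] [] = []
  rows-residue⁺ q a ((d , suc b) ∷ zs) (b<m ∷ bs<m) (_ ∷ bs>0) =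
    subst (λ r → T (not (r ≡ᵇ 0))) (sym (remainder-unique m (suc b) (d + (carry a (suc b) + q)) b<m)) tt ∷
    rows-residue⁺ _ (suc b) zs bs<m bs>0

  rows-residue⁻ : ∀ q a zs → Bounded m (map proj₂ zs) →
    All (λ x → T (not ((x % m) ≡ᵇ 0))) (rows m q a zs) → All (0 <_) (map proj₂ zs)
  rows-residue⁻ q a [] [] [] = []
  rows-residue⁻ q a ((d , zero) ∷ zs) (b<m ∷ bs<m) (t ∷ ts) =
    ⊥-elim (subst (λ r → T (not (r ≡ᵇ 0))) (remainder-unique m 0 (d + (carry a 0 + q)) b<m) t)
  rows-residue⁻ q a ((d , suc b) ∷ zs) (b<m ∷ bs<m) (t ∷ ts) = s≤s z≤n ∷ rows-residue⁻ _ (suc b) zs bs<m ts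

  isWord-pairs : ∀ {n} (xs bs : Vec ℕ n) → IsWord (n , bs , xs) →
    All (0 <_) (map proj₂ (zipPairs xs bs)) × Bounded m (map proj₂ (zipPairs xs bs))
  isWord-pairs xs bs v rewrite map-proj₂-zipPairs xs bs = v

  pairs-isWord : ∀ {n} (xs bs : Vec ℕ n) →
    All (0 <_) (map proj₂ (zipPairs xs bs)) → Bounded m (map proj₂ (zipPairs xs bs)) → IsWord (n , bs , xs)
  pairs-isWord xs bs v v′ rewrite map-proj₂-zipPairs xs bs = v , v′

  distinctRows-flat : ∀ {c} → IsWord c → Flat m 0 (distinctRows c)
  distinctRows-flat {_ , bs , ks} v = rows-flat m 0 0 (expand (zipPairs ks bs)) 0<m
    (All-expand⁺ (zipPairs ks bs) 0<m (proj₂ (isWord-pairs ks bs v)))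

  distinctRows-increasing : ∀ {c} → IsWord c → Increasing 1 (distinctRows c)
  distinctRows-increasing {_ , bs , ks} v with isWord-pairs ks bs v
  ... | bs>0 , bs<m = rows-increasing-1 (flat (expand zs)) (bounded-flat zs bs<m)
    (subst (λ w → All (0 <_) (take 1 w)) (sym (map-proj₂-flat (expand zs))) (take-1-expand zs bs>0))
    where zs = zipPairs ks bs

  toDistinct-inD : ∀ {c} → IsWord c → T (inD m (toDistinct c))
  toDistinct-inD {c} v = inD⁺ m {toDistinct c} (mult-blocks m (distinctRows-flat {c} v))

  toDistinct-injective : ∀ {c c′} → IsWord c → IsWord c′ → toDistinct c ≡ toDistinct c′ → c ≡ c′
  toDistinct-injective {c@(n , bs , ks)} {c′@(n′ , bs′ , ks′)} v v′ eq
    with isWord-pairs ks bs v | isWord-pairs ks′ bs′ v′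
       | distinctRows-increasing {c} v | distinctRows-increasing {c′} v′
  ... | bs>0 , bs<m | bs>0′ , bs<m′ | inc | inc′
    with blocks-injective (Increasing-weaken z≤n inc) (Increasing-weaken z≤n inc′)
           (trans (sym (part-1-blocks inc)) (trans (cong (λ μ → part μ 1) eq) (part-1-blocks inc′))) eq
  ... | eq₁ with rows-injective m 0 0 _ _ (bounded-flat _ bs<m) (bounded-flat _ bs<m′) eq₁
  ... | eq₂ with expand-injective-++ 0 0 _ _ bs>0 bs>0′
      (trans (sym (map-proj₂-flat _)) (trans (cong (map proj₂) eq₂) (map-proj₂-flat _)))
  ... | _ , eq₃ with zipPairs-injective-length ks bs ks′ bs′ eq₃
  ... | refl with zipPairs-injective ks bs ks′ bs′ eq₃
  ... | refl , refl = refl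

  toDistinct-surjective : ∀ {k μ} → Partition k μ → T (inD m μ) → ∃ λ c → IsWord c × toDistinct c ≡ μ
  toDistinct-surjective [] _ = (0 , [] , []) , ([] , []) , refl
  toDistinct-surjective {μ = μ@(j ∷ js)} (cons 1≤j _ ptn) inDμ
    with blocks-surjective m j 0 (cons 1≤j ≤-refl ptn) (inD⁻ m {μ} inDμ)
  ... | ys , len , fl , eq with rows-flat-surjective m 0 0 ys 0<m fl
  ... | w , w<m , refl with expand-surjective w (head-positive w len eq)
    where
    -- If the word ended in 0, the smallest row would be 0 and its block empty. All parts of the
    -- conjugate would then be below `j`, although `j` is one of them.
    head-positive : ∀ w → length (rows m 0 0 (flat w)) ≡ j → blocks 0 (rows m 0 0 (flat w)) ≡ j ∷ js →
      All (0 <_) (take 1 w)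
    head-positive [] len eq = []
    head-positive (suc b ∷ w) len eq = s≤s z≤n ∷ []
    head-positive (zero ∷ w) len eq
      with subst (Partition _) eq (blocks-partition 0 (rows m 0 0 (flat w)))
    ... | cons _ j≤ _ = ⊥-elim (<⇒≱ (≤-reflexive len) j≤)
  ... | zs , refl , bs>0 with zipPairs-surjective zs
  ... | n , ks , bs , refl = (n , bs , ks) , pairs-isWord ks bs bs>0 (All-expand⁻ (zipPairs ks bs) w<m) , eq

  toRegular-partition : ∀ {c} → IsWord c → ∃ λ k → Partition k (toRegular c)
  toRegular-partition {_ , bs , ks} v with isWord-pairs (insertZeros bs ks) bs v
  ... | bs>0 , bs<m = ʳ++-partition ≤-refl
    (rows-increasing-1 (zipPairs (insertZeros bs ks) bs) bs<m (All.take⁺ 1 bs>0)) []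

  toRegular-inO : ∀ {c} → IsWord c → T (inO m (toRegular c))
  toRegular-inO {c@(_ , bs , ks)} v with isWord-pairs (insertZeros bs ks) bs v
  ... | bs>0 , bs<m = T-foldr-∧⁺ (λ x → not ((x % m) ≡ᵇ 0)) (toRegular c)
    (All-ʳ++ (rows-residue⁺ 0 0 (zipPairs (insertZeros bs ks) bs) bs<m bs>0) [])

  toRegular-injective : ∀ {c c′} → IsWord c → IsWord c′ → toRegular c ≡ toRegular c′ → c ≡ c′
  toRegular-injective {n , bs , ks} {n′ , bs′ , ks′} v v′ eq
    with isWord-pairs (insertZeros bs ks) bs v | isWord-pairs (insertZeros bs′ ks′) bs′ v′
  ... | _ , bs<m | _ , bs<m′ with rows-injective m 0 0 _ _ bs<m bs<m′ (reverse-injective eq)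
  ... | eq₁ with zipPairs-injective-length (insertZeros bs ks) bs (insertZeros bs′ ks′) bs′ eq₁
  ... | refl with zipPairs-injective (insertZeros bs ks) bs (insertZeros bs′ ks′) bs′ eq₁
  ... | eq₂ , refl = cong (λ xs → n , bs , xs) (insertZeros-injective bs ks ks′ eq₂)

  toRegular-surjective : ∀ {k la} → Partition k la → T (inO m la) → ∃ λ c → IsWord c × toRegular c ≡ la
  toRegular-surjective {la = la} ptn inOla
    with rows-surjective m 0 0 (reverse la) 0<m (ʳ++-increasing ptn [])
  ... | zs , bs<m , eq with zipPairs-surjective zs
  ... | n , ds , bs , refl with insertZeros-surjective bs ds
  ... | ks , refl = (n , bs , ks) ,
    pairs-isWord (insertZeros bs ks) bs
      (rows-residue⁻ 0 0 (zipPairs (insertZeros bs ks) bs) bs<m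
        (subst (All _) (sym eq) (All-ʳ++ (T-foldr-∧⁻ (λ x → not ((x % m) ≡ᵇ 0)) la inOla) [])))
      bs<m ,
    trans (cong reverse eq) (reverse-involutive la)

  -- Each size is the sum of the letters plus `m` times a row weight. Inserted zeros do not change
  -- the sum of the letters, and `maj-insertZeros` says that the row weights agree.
  sum-toDistinct : ∀ {c} → IsWord c → sum (toDistinct c) ≡ sum (toRegular c)
  sum-toDistinct {c@(n , bs , ks)} v@(bs>0 , _) = begin
    sum (blocks 0 (distinctRows c))
      ≡⟨ +-identityʳ _ ⟨
    sum (blocks 0 (distinctRows c)) + 0
      ≡⟨ sum-blocks (Increasing-weaken z≤n (distinctRows-increasing {c} v)) ⟩
    sum (distinctRows c)
      ≡⟨ sum-rows m 0 0 (flat w) ⟩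
    sum (map proj₂ (flat w)) + m * rowWeight m 0 (flat w)
      ≡⟨ cong₂ (λ x y → x + m * y) (cong sum (map-proj₂-flat w)) (rowWeight-flat m 0 w) ⟩
    sum w + m * maj 0 w
      ≡⟨ cong₂ (λ x y → x + m * y) (sum-expand (zipPairs ks bs)) (maj-insertZeros bs ks bs>0) ⟩
    sum (map proj₂ (zipPairs ks bs)) + m * (weight ds + maj 0 (toList bs))
      ≡⟨ cong₂ (λ x y → sum x + m * y) (trans (map-proj₂-zipPairs ks bs) (sym (map-proj₂-zipPairs ds bs)))
               (sym (rowWeight-zipPairs m 0 ds bs)) ⟩
    sum (map proj₂ (zipPairs ds bs)) + m * rowWeight m 0 (zipPairs ds bs)
      ≡⟨ sum-rows m 0 0 (zipPairs ds bs) ⟨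
    sum (regularRows c)
      ≡⟨ +-identityʳ _ ⟨
    sum (regularRows c) + 0
      ≡⟨ sum-ʳ++ (regularRows c) [] ⟨
    sum (toRegular c) ∎
    where
    open ≡-Reasoning
    w = expand (zipPairs ks bs)
    ds = insertZeros bs ks

  sᵢ-toDistinct : ∀ {c i} → IsWord c → i < m →
    sᵢ m (suc i) (toDistinct c) ≡ mult (suc i % m) (expand (zipPairs (proj₂ (proj₂ c)) (proj₁ (proj₂ c))))
  sᵢ-toDistinct {c@(_ , bs , ks)} {i} v i<m = begin
    sᵢ m (suc i) (toDistinct c)
      ≡⟨ sᵢ-blocks m i<m (distinctRows-increasing {c} v) ⟩
    countᵇ (λ y → (y % m) ≡ᵇ (suc i % m)) (distinctRows c)
      ≡⟨ countᵇ-rows m (suc i % m) 0 0 (flat w) (bounded-flat _ (proj₂ (isWord-pairs ks bs v))) ⟩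
    mult (suc i % m) (map proj₂ (flat w))
      ≡⟨ cong (mult (suc i % m)) (map-proj₂-flat w) ⟩
    mult (suc i % m) w ∎
    where
    open ≡-Reasoning
    w = expand (zipPairs ks bs)

  ℓᵢ-toRegular : ∀ {c} i → IsWord c → ℓᵢ m i (toRegular c) ≡ mult (i % m) (toList (proj₁ (proj₂ c)))
  ℓᵢ-toRegular {c@(_ , bs , ks)} i v = begin
    ℓᵢ m i (toRegular c)
      ≡⟨ countᵇ-ʳ++ (λ x → (x % m) ≡ᵇ (i % m)) (regularRows c) [] ⟩
    countᵇ (λ x → (x % m) ≡ᵇ (i % m)) (regularRows c) + 0
      ≡⟨ +-identityʳ _ ⟩
    countᵇ (λ x → (x % m) ≡ᵇ (i % m)) (regularRows c)
      ≡⟨ countᵇ-rows m (i % m) 0 0 (zipPairs ds bs) (proj₂ (isWord-pairs ds bs v)) ⟩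
    mult (i % m) (map proj₂ (zipPairs ds bs))
      ≡⟨ cong (mult (i % m)) (map-proj₂-zipPairs ds bs) ⟩
    mult (i % m) (toList bs) ∎
    where
    open ≡-Reasoning
    ds = insertZeros bs ks

  asc-toRegular : ∀ {c} → IsWord c →
    part (toRegular c) 1 / m ≡ Vec.sum (proj₂ (proj₂ c)) + asc m (toRegular c)
  asc-toRegular {c@(_ , bs , ks)} v =
    trans (asc-reverse-rows m (zipPairs ds bs) (proj₂ (isWord-pairs ds bs v)))
      (cong (_+ asc m (toRegular c))
        (trans (cong sum (map-proj₁-zipPairs ds bs)) (trans (sum-toList ds) (sum-insertZeros bs ks))))
    where ds = insertZeros bs ks

  -- For `suc i < m` both sides count a nonzero letter, which inserted zeros do not affect. For
  -- `suc i = m` the residue is 0, and both sides are the number of inserted zeros.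
  exponent : ∀ {c i} → IsWord c → i < m →
    ℤ.+ sᵢ m (suc i) (toDistinct c) ≡
      (if suc i <ᵇ m then ℤ.+ ℓᵢ m (suc i) (toRegular c)
       else (ℤ.+ (part (toRegular c) 1 / m)) ℤ.- (ℤ.+ asc m (toRegular c)))
  exponent {c@(_ , bs , ks)} {i} v i<m with suc i <ᵇ m | <ᵇ-reflects-< (suc i) m
  ... | true | ofʸ 1+i<m = cong ℤ.+_ (trans (sᵢ-toDistinct {c} v i<m)
    (trans (residue (m<n⇒m%n≡m 1+i<m)) (sym (ℓᵢ-toRegular {c} (suc i) v))))
    where
    residue : ∀ {r} → r ≡ suc i → mult r (expand (zipPairs ks bs)) ≡ mult r (toList bs)
    residue refl = trans (mult-expand-suc i (zipPairs ks bs)) (cong (mult (suc i)) (map-proj₂-zipPairs ks bs))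
  ... | false | ofⁿ 1+i≮m = begin
    ℤ.+ sᵢ m (suc i) (toDistinct c)
      ≡⟨ cong ℤ.+_ (sᵢ-toDistinct {c} v i<m) ⟩
    ℤ.+ mult (suc i % m) (expand (zipPairs ks bs))
      ≡⟨ cong (λ r → ℤ.+ mult r (expand (zipPairs ks bs)))
              (trans (cong (_% m) (≤-antisym i<m (≮⇒≥ 1+i≮m))) (n%n≡0 m)) ⟩
    ℤ.+ mult 0 (expand (zipPairs ks bs))
      ≡⟨ cong ℤ.+_ (mult-expand-zero (zipPairs ks bs) (proj₁ (isWord-pairs ks bs v))) ⟩
    ℤ.+ sum (map proj₁ (zipPairs ks bs))
      ≡⟨ cong ℤ.+_ (trans (cong sum (map-proj₁-zipPairs ks bs)) (sum-toList ks)) ⟩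
    ℤ.+ Vec.sum ks
      -- By `asc-toRegular` the quotient of the largest part is `Vec.sum ks + A`, so the integer
      -- difference is a natural number and truncated subtraction gives the same value.
      ≡⟨ cong ℤ.+_ (m+n∸n≡m (Vec.sum ks) A) ⟨
    ℤ.+ (Vec.sum ks + A ∸ A)
      ≡⟨ ℤ.⊖-≥ (m≤n+m A (Vec.sum ks)) ⟨
    (Vec.sum ks + A) ℤ.⊖ A
      ≡⟨ ℤ.m-n≡m⊖n (Vec.sum ks + A) A ⟨
    ℤ.+ (Vec.sum ks + A) ℤ.- ℤ.+ A
      ≡⟨ cong (λ x → ℤ.+ x ℤ.- ℤ.+ A) (asc-toRegular {c} v) ⟨
    ℤ.+ (part (toRegular c) 1 / m) ℤ.- ℤ.+ A ∎
    where
    open ≡-Reasoning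
    A = asc m (toRegular c)

  lhsExp≡rhsExp : ∀ {c} → IsWord c → lhsExp m (toDistinct c) ≡ rhsExp m (toRegular c)
  lhsExp≡rhsExp {c} v = tabulate-cong (λ i → exponent {c} v (toℕ<n i))

theorem1p4 : (m : ℕ) .{{_ : NonZero m}} → 2 ≤ m →
    (n : ℕ) (e : Vec ℤ m) → lhsCoeff m n e ≡ rhsCoeff m n e
theorem1p4 m _ n e = ≤-antisym
  -- Two partitions correspond if they encode the same word. In each direction, surjectivity of the
  -- encoding on the source side provides a partner, and injectivity of the other encoding shows
  -- that the partner determines the word.
  (countᵇ-partitions-≤ _ _ Corresponds n
    (λ {μ} ptn Σ≡ t →
       let inDμ , e≡ = Equivalence.to (T-∧ {inD m μ}) t
           c , v , eq = toDistinct-surjective m ptn inDμ in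
       toRegular m c , toRegular-partition m {c} v ,
       trans (sym (sum-toDistinct m {c} v)) (trans (cong sum eq) Σ≡) ,
       Equivalence.from (T-∧ {inO m (toRegular m c)}) (toRegular-inO m {c} v ,
         fromWitness (trans (sym (lhsExp≡rhsExp m {c} v)) (trans (cong (lhsExp m) eq) (toWitness e≡)))) ,
       c , v , eq , refl)
    (λ (c , v , eqD , eqO) (c′ , v′ , eqD′ , eqO′) →
       trans (sym eqD) (trans (cong (toDistinct m)
         (toRegular-injective m {c} {c′} v v′ (trans eqO (sym eqO′)))) eqD′)))
  (countᵇ-partitions-≤ _ _ (λ la μ → Corresponds μ la) n
    (λ {la} ptn Σ≡ t →
       let inOla , e≡ = Equivalence.to (T-∧ {inO m la}) t
           c , v , eq = toRegular-surjective m ptn inOla in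
       toDistinct m c , (_ , blocks-partition 0 (distinctRows m c)) ,
       trans (sum-toDistinct m {c} v) (trans (cong sum eq) Σ≡) ,
       Equivalence.from (T-∧ {inD m (toDistinct m c)}) (toDistinct-inD m {c} v ,
         fromWitness (trans (lhsExp≡rhsExp m {c} v) (trans (cong (rhsExp m) eq) (toWitness e≡)))) ,
       c , v , refl , eq)
    (λ (c , v , eqD , eqO) (c′ , v′ , eqD′ , eqO′) →
       trans (sym eqO) (trans (cong (toRegular m)
         (toDistinct-injective m {c} {c′} v v′ (trans eqD (sym eqD′)))) eqO′)))
  where
  Corresponds : List ℕ → List ℕ → Set
  Corresponds μ la = ∃ λ c → IsWord m c × toDistinct m c ≡ μ × toRegular m c ≡ la
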